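{- Let $G$ be a finite simple graph with maximum degree $\Delta(G)\le 6$. Then $\chi'_s(G)\le 57$.
   Context: A strong edge coloring of a graph $G$ is an edge coloring such that every color class is an induced matching of $G$; equivalently, it is a proper vertex coloring of $L(G)^2$, the square of the line graph of $G$. The strong chromatic index $\chi'_s(G)$ is the smallest integer $k$ such that $G$ admits a strong edge coloring with $k$ colors. -}

module Defs where

open import Data.Empty using (⊥-elim-irr)
open import Data.Fin using (Fin; zero; suc; _<_)
open import Data.Fin.Properties
  using (_≟_; _<?_; any?; all?; <-trans; <-irrefl)
open import Data.Fin.Subset using (Subset; ∣_∣)
open import Data.List using (List; []; _∷_; map; allFin; concatMap; length; lookup)
open import Data.List.Extrema.Nat using (max)
open import Data.List.Membership.Propositional using (_∈_; lose)
open import Data.List.Membership.Propositional.Properties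
  using (∈-allFin; ∈-concatMap⁺)
import Data.List.Relation.Unary.All as All
import Data.List.Relation.Unary.Any as Any
open import Data.List.Relation.Unary.Any using (here; index)
open import Data.List.Relation.Unary.Any.Properties using (lookup-index)
open import Data.Nat using (ℕ; zero; suc; _≤_; z≤n; s≤s)
open import Data.Product using (_×_; _,_; ∃; proj₁; proj₂)
open import Data.Sum using (_⊎_; inj₁; inj₂)
open import Data.Vec using (tabulate)
open import Data.Vec.Functional using (head; tail) renaming ([] to []ᶠ; _∷_ to _∷ᶠ_)
open import Function using (_∘_)
open import Level using (0ℓ)
open import Relation.Binary
  using (Rel; Decidable; DecidableEquality; Symmetric)
open import Relation.Binary.PropositionalEquality
  using (_≡_; _≗_; refl; sym; trans; cong; subst)
open import Relation.Nullary using (Dec; does; yes; no; ¬_)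
open import Relation.Nullary.Decidable using (map′; _×-dec_; _⊎-dec_; _→-dec_)
import Relation.Unary as U
open U using (Pred)

record Graph (n : ℕ) : Set₁ where
  field
    Adj        : Rel (Fin n) 0ℓ
    adj?       : Decidable Adj
    adj-sym    : Symmetric Adj
    adj-irrefl : ∀ {v} → ¬ Adj v v

private
  variable
    n k : ℕ

module _ (G : Graph n) where
  open Graph G

  neighbours : Fin n → Subset n
  neighbours v = tabulate (λ w → does (adj? v w))

  degree : Fin n → ℕ
  degree v = ∣ neighbours v ∣

  -- The graph without vertices has maximum degree 0.
  Δ : ℕ
  Δ = max 0 (map degree (allFin n))

  -- An unordered pair of adjacent vertices is represented by its increasing
  -- listing. The proofs are irrelevant, so _≡_ on edges compares endpoints only.
  record Edge : Set where
    constructor edge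
    field
      end₁ end₂ : Fin n
      .ordered  : end₁ < end₂
      .adjacent : Adj end₁ end₂

module _ {G : Graph n} where
  open Graph G
  open Edge

  infix 4 _isEndOf_

  _isEndOf_ : Fin n → Edge G → Set
  x isEndOf e = x ≡ end₁ e ⊎ x ≡ end₂ e

  EdgeSet : Set₁
  EdgeSet = Pred (Edge G) 0ℓ

  Covers : EdgeSet → Fin n → Set
  Covers M x = ∃ λ e → M e × x isEndOf e

  IsMatching : EdgeSet → Set
  IsMatching M = ∀ e f → M e → M f → ∀ x → x isEndOf e → x isEndOf f → e ≡ f

  -- M contains every edge of the subgraph of G induced by the vertices M covers.
  IsInduced : EdgeSet → Set
  IsInduced M = ∀ e → Covers M (end₁ e) → Covers M (end₂ e) → M e

  IsInducedMatching : EdgeSet → Set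
  IsInducedMatching M = IsMatching M × IsInduced M

  ColourClass : (Edge G → Fin k) → Fin k → EdgeSet
  ColourClass c i e = c e ≡ i

  IsStrongEdgeColouring : (Edge G → Fin k) → Set
  IsStrongEdgeColouring c = ∀ i → IsInducedMatching (ColourClass c i)

StrongEdgeColourable : Graph n → ℕ → Set
StrongEdgeColourable G k = ∃ λ (c : Edge G → Fin k) → IsStrongEdgeColouring c

-- The strong chromatic index is a least number of colours, so defining it as a
-- function needs colourability to be decidable (by exhaustive search over the
-- finitely many colourings) and some number of colours to suffice (one per edge).

module _ {G : Graph n} where
  open Graph G
  open Edge

  private
    edgesBetween : Fin n → Fin n → List (Edge G)
    edgesBetween u v with (u <? v) ×-dec adj? u v
    ... | yes (u<v , uv) = edge u v u<v uv ∷ []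
    ... | no _           = []

    edgesBetween-complete : ∀ e → e ∈ edgesBetween (end₁ e) (end₂ e)
    edgesBetween-complete (edge u v u<v uv) with (u <? v) ×-dec adj? u v
    ... | yes _ = here refl
    ... | no ¬p = ⊥-elim-irr (¬p (u<v , uv))

  edges : List (Edge G)
  edges = concatMap (λ u → concatMap (edgesBetween u) (allFin n)) (allFin n)

  edges-complete : ∀ e → e ∈ edges
  edges-complete e =
    ∈-concatMap⁺ (λ u → concatMap (edgesBetween u) (allFin n))
      (lose (∈-allFin (end₁ e))
        (∈-concatMap⁺ (edgesBetween (end₁ e))
          (lose (∈-allFin (end₂ e)) (edgesBetween-complete e))))

  edgeIndex : Edge G → Fin (length edges)
  edgeIndex e = index (edges-complete e)

  lookup-edgeIndex : ∀ e → e ≡ lookup edges (edgeIndex e)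
  lookup-edgeIndex e = lookup-index (edges-complete e)

  edgeIndex-injective : ∀ {e f} → edgeIndex e ≡ edgeIndex f → e ≡ f
  edgeIndex-injective {e} {f} eq =
    trans (lookup-edgeIndex e)
      (trans (cong (lookup edges) eq) (sym (lookup-edgeIndex f)))

  infix 4 _≟ᵉ_

  _≟ᵉ_ : DecidableEquality (Edge G)
  edge u v _ _ ≟ᵉ edge u′ v′ _ _ =
    map′ (λ { (refl , refl) → refl }) (λ { refl → refl , refl })
      ((u ≟ u′) ×-dec (v ≟ v′))

  anyEdge? : {P : EdgeSet} → U.Decidable P → Dec (∃ P)
  anyEdge? P? =
    map′ Any.satisfied (λ (e , p) → lose (edges-complete e) p) (Any.any? P? edges)

  allEdges? : {P : EdgeSet} → U.Decidable P → Dec (∀ e → P e)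
  allEdges? P? =
    map′ (λ ps e → All.lookup ps (edges-complete e)) (λ p → All.universal p edges)
      (All.all? P? edges)

  isEndOf? : ∀ x (e : Edge G) → Dec (x isEndOf e)
  isEndOf? x e = (x ≟ end₁ e) ⊎-dec (x ≟ end₂ e)

  isInducedMatching? : {M : EdgeSet} → U.Decidable M → Dec (IsInducedMatching M)
  isInducedMatching? {M} M? = matching? ×-dec induced?
    where
    covers? : U.Decidable (Covers M)
    covers? x = anyEdge? λ e → M? e ×-dec isEndOf? x e

    matching? : Dec (IsMatching M)
    matching? = allEdges? λ e → allEdges? λ f → M? e →-dec (M? f →-dec
      all? λ x → isEndOf? x e →-dec (isEndOf? x f →-dec (e ≟ᵉ f)))

    induced? : Dec (IsInduced M)
    induced? = allEdges? λ e →
      covers? (end₁ e) →-dec (covers? (end₂ e) →-dec M? e)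

  isStrongEdgeColouring? : (c : Edge G → Fin k) → Dec (IsStrongEdgeColouring c)
  isStrongEdgeColouring? c = all? λ i → isInducedMatching? λ e → c e ≟ i

  isStrongEdgeColouring-resp : {c d : Edge G → Fin k} → c ≗ d →
    IsStrongEdgeColouring c → IsStrongEdgeColouring d
  isStrongEdgeColouring-resp {c = c} {d = d} c≗d strong i =
    (λ e f de df → proj₁ (strong i) e f (toC e de) (toC f df)) ,
    (λ e cov₁ cov₂ →
      trans (sym (c≗d e)) (proj₂ (strong i) e (coversC cov₁) (coversC cov₂)))
    where
    toC : ∀ e → ColourClass d i e → ColourClass c i e
    toC e de = trans (c≗d e) de

    coversC : ∀ {x} → Covers (ColourClass d i) x → Covers (ColourClass c i) x
    coversC (e , de , x∈e) = e , toC e de , x∈e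

private
  anyFunction? : ∀ m {P : Pred (Fin m → Fin k) 0ℓ} →
    (∀ {f g} → f ≗ g → P f → P g) → U.Decidable P → Dec (∃ P)
  anyFunction? zero resp P? =
    map′ ([]ᶠ ,_) (λ (_ , p) → resp (λ ()) p) (P? []ᶠ)
  anyFunction? (suc m) {P} resp P? =
    map′ (λ (i , f , p) → (i ∷ᶠ f) , p)
      (λ (f , p) → head f , tail f , resp (λ { zero → refl ; (suc _) → refl }) p)
      (any? λ i → anyFunction? m
        (λ f≗g → resp λ { zero → refl ; (suc j) → f≗g j })
        (λ f → P? (i ∷ᶠ f)))

  least : {P : Pred ℕ 0ℓ} → U.Decidable P → ∀ k → P k →
    ∃ λ m → P m × (∀ {j} → P j → m ≤ j)
  least P? zero    p = zero , p , λ _ → z≤n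
  least {P} P? (suc k) p with P? zero
  ... | yes p₀ = zero , p₀ , λ _ → z≤n
  ... | no ¬p₀ with m , pm , min ← least (P? ∘ suc) k p = suc m , pm , below
    where
    below : ∀ {j} → P j → suc m ≤ j
    below {zero}  p₀ = ⊥-elim-irr (¬p₀ p₀)
    below {suc j} pj = s≤s (min pj)

module _ (G : Graph n) where
  open Edge

  strongEdgeColourable? : ∀ k → Dec (StrongEdgeColourable G k)
  strongEdgeColourable? k =
    map′ (λ (f , strong) → f ∘ edgeIndex {G = G} , strong)
      (λ (c , strong) → c ∘ lookup (edges {G = G}) ,
        isStrongEdgeColouring-resp (λ e → cong c (lookup-edgeIndex e)) strong)
      (anyFunction? (length (edges {G = G}))
        (λ f≗g → isStrongEdgeColouring-resp (f≗g ∘ edgeIndex {G = G}))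
        (λ f → isStrongEdgeColouring? (f ∘ edgeIndex {G = G})))

  private
    sameEnds : ∀ (e g : Edge G) → end₁ e isEndOf g → end₂ e isEndOf g → e ≡ g
    sameEnds (edge u v u<v _) (edge _ _ _ _) (inj₁ refl) (inj₁ refl) =
      ⊥-elim-irr (<-irrefl refl u<v)
    sameEnds (edge _ _ _ _) (edge _ _ _ _) (inj₁ refl) (inj₂ refl) = refl
    sameEnds (edge _ _ u<v _) (edge _ _ v<u _) (inj₂ refl) (inj₁ refl) =
      ⊥-elim-irr (<-irrefl refl (<-trans u<v v<u))
    sameEnds (edge u v u<v _) (edge _ _ _ _) (inj₂ refl) (inj₂ refl) =
      ⊥-elim-irr (<-irrefl refl u<v)

  edgeIndex-strong : IsStrongEdgeColouring {G = G} edgeIndex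
  edgeIndex-strong i =
    (λ e f ei fi _ _ _ → edgeIndex-injective (trans ei (sym fi))) ,
    (λ { e (f , fi , x∈f) (g , gi , y∈g) →
      let f≡g = edgeIndex-injective (trans fi (sym gi))
          e≡g = sameEnds e g (subst (end₁ e isEndOf_) f≡g x∈f) y∈g
      in trans (cong edgeIndex e≡g) gi })

  private
    leastColourable : ∃ λ m → StrongEdgeColourable G m ×
      (∀ {j} → StrongEdgeColourable G j → m ≤ j)
    leastColourable =
      least strongEdgeColourable? (length (edges {G = G})) (edgeIndex , edgeIndex-strong)

  χ′ₛ : ℕ
  χ′ₛ = proj₁ leastColourable

  χ′ₛ-colourable : StrongEdgeColourable G χ′ₛ
  χ′ₛ-colourable = proj₁ (proj₂ leastColourable)

  χ′ₛ-minimal : ∀ {k} → StrongEdgeColourable G k → χ′ₛ ≤ k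
  χ′ₛ-minimal = proj₂ (proj₂ leastColourable)

{-# OPTIONS --safe #-}

-- An edge uv is in conflict with the edges at its neighbours, that is with at most 10 · 6 = 60
-- others, so 57 colours suffice greedily as soon as four of these 60 are redundant: uncoloured,
-- counted twice, or sharing a colour with another one. Colour a component in the order of
-- decreasing distance from a root R. An edge away from R sees a vertex closer to R whose
-- star is still uncoloured, which makes six redundant edges, or four if two of them were precoloured.
-- It remains to choose R so that the edges at R can be coloured last:
-- * a vertex of degree at most 5, or a triangle, where the count itself is smaller;
-- * a square a x b y in a triangle-free 6-regular component. Its four edges count one another
--   twice, and three further units are saved because opposite corners have another common
--   neighbour or two edges that can be precoloured alike; a degree count finds a square for
--   which two units come from a, b and one from x, y;
-- * any vertex v if there are no triangles and squares: then five of its neighbours have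
--   pairwise compatible edges away from v, which are precoloured alike.
module Submission where

open import Defs
open import Data.Empty using (⊥; ⊥-elim; ⊥-elim-irr)
open import Data.Fin using (Fin; zero; suc)
import Data.Fin.Properties as Fin
open import Data.Fin.Subset using (∣_∣)
open import Data.List
  using (List; []; _∷_; _++_; map; filter; concatMap; mapMaybe; length; allFin; cartesianProduct)
import Data.List as List
open import Data.List.Extrema.Nat using (xs≤max)
open import Data.List.Membership.Propositional using (_∈_; _∉_; lose; find)
open import Data.List.Membership.Propositional.Properties
  using (∈-allFin; ∈-filter⁺; ∈-filter⁻; ∈-map⁺; ∈-concatMap⁺; ∈-++⁺ˡ; ∈-++⁺ʳ; ∈-++⁻; ∈-cartesianProduct⁺)
import Data.List.Membership.DecPropositional as DecMembership
open import Data.List.Properties using (length-tabulate; length-map; length-++; filter-notAll; length-mapMaybe)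
open import Data.List.Relation.Binary.Subset.Propositional using (_⊆_)
open import Data.List.Relation.Unary.All as All using (All; []; _∷_)
import Data.List.Relation.Unary.All.Properties as All
open import Data.List.Relation.Unary.Any as Any using (Any; here; there)
import Data.List.Relation.Unary.Any.Properties as Any
open import Data.List.Relation.Unary.AllPairs using (AllPairs; []; _∷_)
import Data.List.Relation.Unary.AllPairs.Properties as AllPairs
open import Data.List.Relation.Unary.Unique.Propositional using (Unique)
open import Data.List.Relation.Unary.Unique.Propositional.Properties using (allFin⁺; filter⁺)
open import Data.Maybe using (Maybe; just; nothing; fromMaybe; _<∣>_)
open import Data.Maybe.Properties using (just-injective)
import Data.Maybe.Relation.Unary.Any as MAny
open import Data.Nat using (ℕ; zero; suc; _+_; _*_; _≤_; _<_; z≤n; s≤s)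
open import Data.Nat.Properties
open import Data.Product using (_×_; _,_; ∃; ∃₂; proj₁; proj₂; uncurry)
open import Data.Product.Properties using (≡-dec)
open import Data.Sum using (_⊎_; inj₁; inj₂; [_,_]; swap; map₁; map₂)
open import Data.Vec using (tabulate)
open import Level using (0ℓ)
open import Function using (_∘_; id; case_of_)
open import Relation.Binary using (DecidableEquality)
open import Relation.Binary.PropositionalEquality
  using (_≡_; _≢_; refl; sym; trans; cong; cong₂; subst)
open import Relation.Nullary using (Dec; does; yes; no; ¬_)
open import Relation.Nullary.Decidable using (map′; _×-dec_; _⊎-dec_; ¬?; decidable-stable; recompute)
open import Relation.Unary using (Pred; Decidable)

-- Counting in lists and the pigeonhole principle.

length-filter-does : ∀ {A : Set} {P : Pred A 0ℓ} (P? : Decidable P) {m} (f : Fin m → A) →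
  length (filter P? (List.tabulate f)) ≡ ∣ tabulate (does ∘ P? ∘ f) ∣
length-filter-does P? {zero} f = refl
length-filter-does P? {suc m} f with P? (f zero)
... | yes _ = cong suc (length-filter-does P? (f ∘ suc))
... | no _ = length-filter-does P? (f ∘ suc)

length-filter-¬? : ∀ {A : Set} {P : Pred A 0ℓ} (P? : Decidable P) xs →
  length (filter (¬? ∘ P?) xs) + length (filter P? xs) ≡ length xs
length-filter-¬? P? [] = refl
length-filter-¬? P? (x ∷ xs) with P? x
... | yes _ = trans (+-suc _ _) (cong suc (length-filter-¬? P? xs))
... | no _ = cong suc (length-filter-¬? P? xs)

length-concatMap≤ : ∀ {A B : Set} {f : A → List B} {b xs} → All (λ x → length (f x) ≤ b) xs →
  length (concatMap f xs) ≤ length xs * b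
length-concatMap≤ [] = z≤n
length-concatMap≤ {f = f} {xs = x ∷ _} (≤b ∷ ≤bs) =
  ≤-trans (≤-reflexive (length-++ (f x))) (+-mono-≤ ≤b (length-concatMap≤ ≤bs))

∈-mapMaybe⁺ : ∀ {A B : Set} {f : A → Maybe B} {x y xs} → x ∈ xs → f x ≡ just y → y ∈ mapMaybe f xs
∈-mapMaybe⁺ {f = f} {y = y} {xs} x∈xs fx≡y =
  Any.mapMaybe⁺ f xs (Any.map⁺ (Any.map
    (λ { refl → subst (MAny.Any (y ≡_)) (sym fx≡y) (MAny.just refl) }) x∈xs))

module _ {A : Set} (_≟_ : DecidableEquality A) where
  open DecMembership _≟_ using (_∈?_; _∉?_)

  remove : A → List A → List A
  remove x = filter (λ y → ¬? (y ≟ x))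

  ∈-remove⁺ : ∀ {x y xs} → y ∈ xs → y ≢ x → y ∈ remove x xs
  ∈-remove⁺ {x} = ∈-filter⁺ (λ y → ¬? (y ≟ x))

  length-remove : ∀ {x xs} → x ∈ xs → length (remove x xs) < length xs
  length-remove {x} {xs} x∈xs =
    filter-notAll (λ y → ¬? (y ≟ x)) xs (Any.map (λ { refl x≢x → x≢x refl }) x∈xs)

  Unique-⊆⇒length≤ : ∀ {xs ys : List A} → Unique xs → xs ⊆ ys → length xs ≤ length ys
  Unique-⊆⇒length≤ [] _ = z≤n
  Unique-⊆⇒length≤ {x ∷ xs} {ys} (x∉xs ∷ uniq) xs⊆ys =
    ≤-<-trans
      (Unique-⊆⇒length≤ uniq λ y∈xs →
        ∈-remove⁺ (xs⊆ys (there y∈xs)) (All.lookup x∉xs y∈xs ∘ sym))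
      (length-remove (xs⊆ys (here refl)))

  -- The pigeonhole principle in the form in which choices are made below: a free colour, a new
  -- neighbour or a further common neighbour escapes a shorter list.
  Unique-escapes : ∀ {xs} → Unique xs → ∀ ys → length ys < length xs → ∃ λ x → x ∈ xs × x ∉ ys
  Unique-escapes {xs} uniq ys ys<xs with Any.any? (_∉? ys) xs
  ... | yes any = find any
  ... | no none = ⊥-elim (<⇒≱ ys<xs (Unique-⊆⇒length≤ uniq λ {x} x∈xs →
    decidable-stable (x ∈? ys) (none ∘ lose x∈xs)))

  length-filter-∉ : ∀ {rs xs} → Unique rs → rs ⊆ xs →
    length (filter (_∉? rs) xs) + length rs ≤ length xs
  length-filter-∉ {rs} {xs} uniq rs⊆xs = begin
    length (filter (_∉? rs) xs) + length rs
      ≤⟨ +-monoʳ-≤ _ (Unique-⊆⇒length≤ uniq λ r∈rs → ∈-filter⁺ (_∈? rs) (rs⊆xs r∈rs) r∈rs) ⟩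
    length (filter (_∉? rs) xs) + length (filter (_∈? rs) xs)
      ≡⟨ length-filter-¬? (_∈? rs) xs ⟩
    length xs ∎
    where open ≤-Reasoning

-- Partial colourings and their greedy extension.

module ChromaticBound {n : ℕ} (G : Graph n) (degree≤6 : ∀ v → degree G v ≤ 6) where
  open Graph G
  open DecMembership (Fin._≟_ {n}) using (_∈?_; _∉?_)

  V : Set
  V = Fin n

  N : V → List V
  N v = filter (adj? v) (allFin n)

  ∈N⁺ : ∀ {v w} → Adj v w → w ∈ N v
  ∈N⁺ {v} {w} = ∈-filter⁺ (adj? v) (∈-allFin w)

  ∈N⁻ : ∀ {v w} → w ∈ N v → Adj v w
  ∈N⁻ {v} w∈N = proj₂ (∈-filter⁻ (adj? v) {xs = allFin n} w∈N)

  N-unique : ∀ v → Unique (N v)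
  N-unique v = filter⁺ (adj? v) (allFin⁺ n)

  length-N≤6 : ∀ v → length (N v) ≤ 6
  length-N≤6 v = ≤-trans (≤-reflexive (length-filter-does (adj? v) id)) (degree≤6 v)

  adj⇒≢ : ∀ {u v} → Adj u v → u ≢ v
  adj⇒≢ uv refl = adj-irrefl uv

  -- Partial colourings live on ordered pairs, so that an edge can be read from either end;
  -- `symmetric` in `Proper` makes both readings agree.
  Colouring : Set
  Colouring = V → V → Maybe (Fin 57)

  record Proper (c : Colouring) : Set where
    field
      symmetric : ∀ u v → c u v ≡ c v u
      onEdges   : ∀ {u v k} → c u v ≡ just k → Adj u v
      -- z – u – w – x is a walk, possibly with x = u, so that adjacent edges are included.
      clashFree : ∀ {z u w x k} → Adj u w → w ≢ z → c z u ≡ just k → c w x ≡ just k → ⊥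

    flip : ∀ {u v k} → c u v ≡ just k → c v u ≡ just k
    flip {u} {v} = trans (symmetric v u)

  open Proper

  infix 4 _⊑_
  _⊑_ : Colouring → Colouring → Set
  c ⊑ d = ∀ {u v k} → c u v ≡ just k → d u v ≡ just k

  Coloured : Colouring → V → V → Set
  Coloured c u v = ∃ λ k → c u v ≡ just k

  ∅ : Colouring
  ∅ _ _ = nothing

  ∅-proper : Proper ∅
  ∅-proper = record { symmetric = λ _ _ → refl ; onEdges = λ () ; clashFree = λ _ _ () }

  -- The edges in conflict with uv are the edges at the vertices w with Near u v w.
  Near : V → V → V → Set
  Near u v w = (Adj u w × w ≢ v) ⊎ (Adj v w × w ≢ u)

  Free : Colouring → V → V → Fin 57 → Set
  Free c u v k = ∀ {w x} → Near u v w → Adj w x → c w x ≢ just k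

  Colourable : Colouring → V → V → Set
  Colourable c u v = ∃ (Free c u v)

  colourable-sym : ∀ {c u v} → Colourable c u v → Colourable c v u
  colourable-sym (k , free) = k , λ near → free (swap near)

  Same : V → V → V → V → Set
  Same u v a b = (u ≡ a × v ≡ b) ⊎ (u ≡ b × v ≡ a)

  same? : ∀ u v a b → Dec (Same u v a b)
  same? u v a b = ((u Fin.≟ a) ×-dec (v Fin.≟ b)) ⊎-dec ((u Fin.≟ b) ×-dec (v Fin.≟ a))

  same-sym : ∀ {u v a b} → Same u v a b → Same v u a b
  same-sym (inj₁ (p , q)) = inj₂ (q , p)
  same-sym (inj₂ (p , q)) = inj₁ (q , p)

  abstract
    paint : V → V → Fin 57 → Colouring → Colouring
    paint a b k c u v with same? u v a b
    ... | yes _ = just k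
    ... | no _  = c u v

    paint-new : ∀ {a b k c u v} → Same u v a b → paint a b k c u v ≡ just k
    paint-new {a} {b} {u = u} {v} same with same? u v a b
    ... | yes _ = refl
    ... | no ¬same = ⊥-elim (¬same same)

    paint-old : ∀ {a b k c u v} → ¬ Same u v a b → paint a b k c u v ≡ c u v
    paint-old {a} {b} {u = u} {v} ¬same with same? u v a b
    ... | yes same = ⊥-elim (¬same same)
    ... | no _ = refl

  paint-inv : ∀ {a b k c u v j} → paint a b k c u v ≡ just j → (Same u v a b × j ≡ k) ⊎ c u v ≡ just j
  paint-inv {a} {b} {u = u} {v} eq with same? u v a b
  ... | yes same = inj₁ (same , just-injective (trans (sym eq) (paint-new same)))
  ... | no ¬same = inj₂ (trans (sym (paint-old ¬same)) eq)

  module _ {c : Colouring} {a b : V} {k : Fin 57} (proper : Proper c) where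

    paint-⊑ : (∀ {j} → c a b ≢ just j) → c ⊑ paint a b k c
    paint-⊑ cab {u} {v} eq with same? u v a b
    ... | no ¬same = trans (paint-old ¬same) eq
    ... | yes (inj₁ (refl , refl)) = ⊥-elim (cab eq)
    ... | yes (inj₂ (refl , refl)) = ⊥-elim (cab (flip proper eq))

    paint-proper : Adj a b → Free c a b k → Proper (paint a b k c)
    paint-proper ab free = record { symmetric = symm ; onEdges = edge′ ; clashFree = clash }
      where
      symm : ∀ u v → paint a b k c u v ≡ paint a b k c v u
      symm u v with same? u v a b
      ... | yes same = trans (paint-new same) (sym (paint-new (same-sym same)))
      ... | no ¬same = trans (paint-old ¬same)
        (trans (symmetric proper u v) (sym (paint-old (¬same ∘ same-sym))))

      edge′ : ∀ {u v j} → paint a b k c u v ≡ just j → Adj u v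
      edge′ eq with paint-inv eq
      ... | inj₁ (inj₁ (refl , refl) , _) = ab
      ... | inj₁ (inj₂ (refl , refl) , _) = adj-sym ab
      ... | inj₂ old = onEdges proper old

      free′ : ∀ {u v} → Same u v a b → Free c u v k
      free′ (inj₁ (refl , refl)) = free
      free′ (inj₂ (refl , refl)) = free ∘ swap

      clash : ∀ {z u w x j} → Adj u w → w ≢ z →
        paint a b k c z u ≡ just j → paint a b k c w x ≡ just j → ⊥
      clash {z} {u} {w} {x} uw w≢z eq₁ eq₂ with paint-inv eq₁ | paint-inv eq₂
      ... | inj₂ old₁ | inj₂ old₂ = clashFree proper uw w≢z old₁ old₂
      ... | inj₁ (same₁ , refl) | inj₂ old₂ =
        free′ same₁ (inj₂ (uw , w≢z)) (onEdges proper old₂) old₂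
      -- The old edge `zu` is seen from the new edge `wx` at its end `u`. If `u` is `x`, so that the
      -- two edges share this vertex, it is seen at `z` instead.
      ... | inj₂ old₁ | inj₁ (same₂ , refl) with u Fin.≟ x
      ...   | no u≢x =
        free′ same₂ (inj₁ (adj-sym uw , u≢x)) (adj-sym (onEdges proper old₁)) (flip proper old₁)
      ...   | yes refl =
        free′ same₂ (inj₂ (adj-sym (onEdges proper old₁) , w≢z ∘ sym)) (onEdges proper old₁) old₁
      clash uw w≢z _ _ | inj₁ (inj₁ (refl , refl) , _) | inj₁ (inj₁ (refl , _) , _) = w≢z refl
      clash uw w≢z _ _ | inj₁ (inj₁ (refl , refl) , _) | inj₁ (inj₂ (refl , _) , _) = adj-irrefl uw
      clash uw w≢z _ _ | inj₁ (inj₂ (refl , refl) , _) | inj₁ (inj₁ (refl , _) , _) = adj-irrefl uw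
      clash uw w≢z _ _ | inj₁ (inj₂ (refl , refl) , _) | inj₁ (inj₂ (refl , _) , _) = w≢z refl

  -- `support` confines a phase of the colouring to the edges in `Q`. Later counts use it to know
  -- which edges are still uncoloured.
  record Extends (Q : V → V → Set) (c d : Colouring) : Set where
    field
      proper  : Proper d
      extends : c ⊑ d
      support : ∀ {u v k} → d u v ≡ just k → c u v ≡ just k ⊎ Q u v

  open Extends

  -- All ordered pairs are visited and each uncoloured edge in `Q` is painted. Colourability is
  -- demanded for every extension of `c` within `Q`, so the order of the visits does not matter.
  greedy : (Q : V → V → Set) → (∀ u v → Dec (Q u v)) → (∀ {u v} → Q u v → Q v u) →
    ∀ {c} → Proper c →
    (∀ {d} → Extends Q c d → ∀ {u v} → Adj u v → Q u v → Colourable d u v) →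
    ∃ λ d → Extends Q c d × (∀ {u v} → Adj u v → Q u v → Coloured d u v)
  greedy Q Q? Q-sym {c} c-proper free =
    let d , ext , coloured = upTo (cartesianProduct (allFin n) (allFin n))
    in d , ext , λ {u} {v} → coloured (∈-cartesianProduct⁺ (∈-allFin u) (∈-allFin v))
    where
    upTo : ∀ ps → ∃ λ d → Extends Q c d × (∀ {u v} → (u , v) ∈ ps → Adj u v → Q u v → Coloured d u v)
    upTo [] = c , record { proper = c-proper ; extends = id ; support = inj₁ } , λ ()
    upTo ((a , b) ∷ ps) with upTo ps
    ... | d , ext , coloured with d a b in dab | adj? a b | Q? a b
    ... | just k | _ | _ = d , ext , λ
      { (here refl) _ _ → k , dab ; (there ∈ps) → coloured ∈ps }
    ... | nothing | no ¬ab | _ = d , ext , λ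
      { (here refl) ab → ⊥-elim (¬ab ab) ; (there ∈ps) → coloured ∈ps }
    ... | nothing | yes _ | no ¬qab = d , ext , λ
      { (here refl) _ qab → ⊥-elim (¬qab qab) ; (there ∈ps) → coloured ∈ps }
    ... | nothing | yes ab | yes qab with k , freeₖ ← free ext ab qab =
      paint a b k d ,
      record
        { proper  = paint-proper (proper ext) ab freeₖ
        ; extends = paint-⊑ (proper ext) uncoloured ∘ extends ext
        ; support = λ eq → case paint-inv eq of λ
          { (inj₁ (inj₁ (refl , refl) , _)) → inj₂ qab
          ; (inj₁ (inj₂ (refl , refl) , _)) → inj₂ (Q-sym qab)
          ; (inj₂ old) → support ext old }
        } ,
      λ { (here refl) _ _ → k , paint-new (inj₁ (refl , refl))
        ; (there ∈ps) uv quv → let j , eq = coloured ∈ps uv quv in j , paint-⊑ (proper ext) uncoloured eq }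
      where
      uncoloured : ∀ {j} → d a b ≢ just j
      uncoloured eq with () ← trans (sym dab) eq

  -- Counting forbidden colours.

  colourable-from : ∀ {c u v} ks → length ks ≤ 56 →
    (∀ {w x k} → Near u v w → Adj w x → c w x ≡ just k → k ∈ ks) → Colourable c u v
  colourable-from ks ≤56 covers =
    let k , _ , k∉ks = Unique-escapes Fin._≟_ (allFin⁺ 57) ks
          (≤-trans (s≤s ≤56) (≤-reflexive (sym (length-tabulate id))))
    in k , λ near wx eq → k∉ks (covers near wx eq)

  -- A dart is an edge seen at the centre `w`. An edge with both ends among the centres gives two
  -- darts, and this double counting is one source of redundancy.
  darts : List V → List (V × V)
  darts = concatMap (λ w → map (w ,_) (N w))

  ∈-darts⁺ : ∀ {ws w x} → w ∈ ws → Adj w x → (w , x) ∈ darts ws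
  ∈-darts⁺ {w = w} w∈ws wx =
    ∈-concatMap⁺ (λ w → map (w ,_) (N w)) (lose w∈ws (∈-map⁺ (w ,_) (∈N⁺ wx)))

  length-darts : ∀ ws → length (darts ws) ≤ length ws * 6
  length-darts ws = length-concatMap≤ (All.universal
    (λ w → ≤-trans (≤-reflexive (length-map (w ,_) (N w))) (length-N≤6 w)) ws)

  N∖ : V → V → List V
  N∖ u v = remove Fin._≟_ v (N u)

  ∈N∖⁺ : ∀ {u v w} → Adj u w → w ≢ v → w ∈ N∖ u v
  ∈N∖⁺ uw = ∈-remove⁺ Fin._≟_ (∈N⁺ uw)

  length-N∖ : ∀ {u v} → Adj u v → length (N∖ u v) < length (N u)
  length-N∖ uv = length-remove Fin._≟_ (∈N⁺ uv)

  length-N∖≤5 : ∀ {u v} → Adj u v → length (N∖ u v) ≤ 5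
  length-N∖≤5 {u} uv = ≤-pred (≤-trans (length-N∖ uv) (length-N≤6 u))

  centres : V → V → List V
  centres u v = N∖ u v ++ N∖ v u

  ∈-centres : ∀ {u v w} → Near u v w → w ∈ centres u v
  ∈-centres (inj₁ (uw , w≢v)) = ∈-++⁺ˡ (∈N∖⁺ uw w≢v)
  ∈-centres {u} {v} (inj₂ (vw , w≢u)) = ∈-++⁺ʳ (N∖ u v) (∈N∖⁺ vw w≢u)

  length-centres : ∀ {u v} → Adj u v → length (centres u v) ≤ 10
  length-centres {u} {v} uv = ≤-trans (≤-reflexive (length-++ (N∖ u v)))
    (+-mono-≤ (length-N∖≤5 uv) (length-N∖≤5 (adj-sym uv)))

  -- Nine full stars forbid at most 54 colours and `ps` accounts for all remaining centres, which
  -- makes 56, one less than the supply.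
  colourable-few-centres : ∀ {c u v} zs → length zs ≤ 9 → ∀ ps → length ps ≤ 2 →
    (∀ {w} → Near u v w → w ∈ zs ⊎ (∀ {x k} → c w x ≡ just k → k ∈ ps)) → Colourable c u v
  colourable-few-centres {c} zs zs≤9 ps ps≤2 covers =
    colourable-from (mapMaybe (uncurry c) (darts zs) ++ ps) ≤56 λ near wx eq →
      [ (λ w∈zs → ∈-++⁺ˡ (∈-mapMaybe⁺ (∈-darts⁺ w∈zs wx) eq))
      , (λ few → ∈-++⁺ʳ (mapMaybe (uncurry c) (darts zs)) (few eq)) ] (covers near)
    where
    ≤56 : length (mapMaybe (uncurry c) (darts zs) ++ ps) ≤ 56
    ≤56 = ≤-trans (≤-reflexive (length-++ (mapMaybe (uncurry c) (darts zs))))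
      (+-mono-≤ (≤-trans (length-mapMaybe (uncurry c) (darts zs))
        (≤-trans (length-darts zs) (*-monoˡ-≤ 6 zs≤9))) ps≤2)

  colourable-few-nbrs : ∀ {c u v} zs → length zs ≤ 9 →
    (∀ {w} → Near u v w → w ∈ zs) → Colourable c u v
  colourable-few-nbrs zs zs≤9 covers = colourable-few-centres zs zs≤9 [] z≤n (inj₁ ∘ covers)

  Dart : V → V → V × V → Set
  Dart u v (w , x) = Near u v w × Adj w x

  -- The witness `d` must lie outside `rs`, so that two darts cannot vouch for each other when both
  -- are dropped.
  Redundant : Colouring → V → V → List (V × V) → V × V → Set
  Redundant c u v rs r = (∀ {k} → uncurry c r ≢ just k) ⊎
    ∃ λ d → Dart u v d × d ∉ rs × uncurry c d ≡ uncurry c r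

  -- At most 10 centres give at most 60 darts. Dropping the four in `rs` leaves 56, among which
  -- every colour of a dropped dart still occurs.
  colourable-redundant : ∀ {c u v} → Adj u v → ∀ rs → length rs ≡ 4 → Unique rs →
    All (Dart u v) rs → All (Redundant c u v rs) rs → Colourable c u v
  colourable-redundant {c} {u} {v} uv rs ≡4 uniq rs-darts rs-redundant =
    colourable-from (mapMaybe (uncurry c) ds) ≤56 covers
    where
    _≟ᵈ_ : DecidableEquality (V × V)
    _≟ᵈ_ = ≡-dec Fin._≟_ Fin._≟_
    module D = DecMembership _≟ᵈ_

    ds : List (V × V)
    ds = filter (D._∉? rs) (darts (centres u v))

    ∈-ds : ∀ {d} → Dart u v d → d ∉ rs → d ∈ ds
    ∈-ds (near , wx) = ∈-filter⁺ (D._∉? rs) (∈-darts⁺ (∈-centres near) wx)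

    ≤56 : length (mapMaybe (uncurry c) ds) ≤ 56
    ≤56 = ≤-trans (length-mapMaybe (uncurry c) ds) (+-cancelʳ-≤ 4 _ _ (begin
      length ds + 4                   ≡⟨ cong (length ds +_) (sym ≡4) ⟩
      length ds + length rs           ≤⟨ length-filter-∉ _≟ᵈ_ uniq (λ r∈rs →
                                           let near , wx = All.lookup rs-darts r∈rs
                                           in ∈-darts⁺ (∈-centres near) wx) ⟩
      length (darts (centres u v))    ≤⟨ length-darts (centres u v) ⟩
      length (centres u v) * 6        ≤⟨ *-monoˡ-≤ 6 (length-centres uv) ⟩
      60                              ∎))
      where open ≤-Reasoning

    covers : ∀ {w x k} → Near u v w → Adj w x → c w x ≡ just k → k ∈ mapMaybe (uncurry c) ds
    covers {w} {x} near wx eq with (w , x) D.∈? rs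
    ... | no r∉rs = ∈-mapMaybe⁺ (∈-ds (near , wx) r∉rs) eq
    ... | yes r∈rs with All.lookup rs-redundant r∈rs
    ...   | inj₁ uncoloured = ⊥-elim (uncoloured eq)
    ...   | inj₂ (d , dart , d∉rs , same) = ∈-mapMaybe⁺ (∈-ds dart d∉rs) (trans same eq)

  -- Colouring a component towards a root

  -- Closed lists are unions of components. In the recursion `W` holds the components whose
  -- colouring is deferred to an outer call.
  Closed : List V → Set
  Closed W = ∀ {u v} → u ∈ W → Adj u v → v ∈ W

  live-adj : ∀ {W} → Closed W → ∀ {u v} → u ∉ W → Adj u v → v ∉ W
  live-adj closed u∉W uv v∈W = u∉W (closed v∈W (adj-sym uv))

  -- Precoloured edges may start one step away from `R`: around a single root vertex they start at
  -- its neighbours.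
  Nbhd : List V → V → Set
  Nbhd R u = ∃ λ r → r ∈ R × (u ≡ r ⊎ Adj r u)

  -- The edges with both ends in R are coloured last, just after those with one end in R.
  record Root (W : List V) : Set where
    field
      R           : List V
      r           : V
      r∈R         : r ∈ R
      live        : ∀ {u} → u ∈ R → u ∉ W
      pre         : Colouring
      pre-proper  : Proper pre
      pre-near    : ∀ {u v k} → pre u v ≡ just k → Nbhd R u ⊎ Nbhd R v
      pre-outer   : ∀ {u v k} → u ∈ R → v ∈ R → pre u v ≢ just k
      -- This is the allowance of two extra colours in `colourable-few-centres`, for a vertex whose
      -- star is otherwise uncoloured.
      pre-few     : ∀ w → ∃ λ ps → length ps ≤ 2 × (∀ {x k} → pre w x ≡ just k → k ∈ ps)
      pendant     : ∀ {c} → Proper c → pre ⊑ c →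
                    (∀ {u v k} → u ∈ R → v ∈ R → c u v ≢ just k) →
                    ∀ {u v} → u ∈ R → v ∉ R → Adj u v → Colourable c u v
      core        : ∀ {c} → Proper c → pre ⊑ c →
                    ∀ {u v} → u ∈ R → v ∈ R → Adj u v → Colourable c u v

  -- The measure for termination.
  outside : List V → ℕ
  outside W = length (filter (_∉? W) (allFin n))

  outside-< : ∀ {W X v} → W ⊆ X → v ∈ X → v ∉ W → outside X < outside W
  outside-< {W} {X} {v} W⊆X v∈X v∉W = Unique-⊆⇒length≤ Fin._≟_
    (All.tabulate (λ { w∈ refl → proj₂ (∈-filter⁻ (_∉? X) {xs = allFin n} w∈) v∈X }) ∷
      filter⁺ (_∉? X) (allFin⁺ n))
    λ { (here refl) → ∈-filter⁺ (_∉? W) (∈-allFin v) v∉W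
      ; {w} (there w∈) → ∈-filter⁺ (_∉? W) (∈-allFin w)
          (proj₂ (∈-filter⁻ (_∉? X) {xs = allFin n} w∈) ∘ W⊆X) }

  ColouringOutside : List V → Set
  ColouringOutside W = ∃ λ c → Proper c ×
    (∀ {u v k} → c u v ≡ just k → u ∉ W) ×
    (∀ {u v} → Adj u v → u ∉ W → v ∉ W → Coloured c u v)

  module _ (root : ∀ {W} → Closed W → ∀ {v} → v ∉ W → Root W) where

    module FromRoot {W} (W-closed : Closed W) (ρ : Root W) where
      open Root ρ

      -- Here `X` is the set reached by a search from `R ++ W`. The colouring is built while `X`
      -- shrinks back, so the vertices reached last get their edges first, and apart from `pre` no
      -- edge that meets `X` is coloured.
      Grown : List V → Set
      Grown X = ∃ λ c → Proper c × pre ⊑ c ×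
        (∀ {u v k} → c u v ≡ just k → pre u v ≡ just k ⊎ (u ∉ X × v ∉ X)) ×
        (∀ {u v} → Adj u v → u ∉ X → v ∉ X → Coloured c u v)

      -- The end of the search. Since `X` is closed and contains `R`, the precoloured edges lie
      -- inside `X`, while `c` colours only edges outside it, so their union has no clash.
      grown-closed : ∀ {X} → R ⊆ X → Closed X → ColouringOutside X → Grown X
      grown-closed {X} R⊆X X-closed (c , c-proper , c-outside , coloured) =
        d , d-proper , pre⊑d , (λ eq → map₂ (λ cuv → c-outside cuv , c-outside (flip c-proper cuv)) (d-inv eq)) ,
        d-coloured
        where
        d : Colouring
        d u v = pre u v <∣> c u v

        pre⊑d : pre ⊑ d
        pre⊑d {u} {v} eq rewrite eq = refl

        d-inv : ∀ {u v k} → d u v ≡ just k → pre u v ≡ just k ⊎ c u v ≡ just k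
        d-inv {u} {v} eq with pre u v
        ... | just _  = inj₁ eq
        ... | nothing = inj₂ eq

        nbhd-in : ∀ {u} → Nbhd R u → u ∈ X
        nbhd-in (r , r∈R , inj₁ refl) = R⊆X r∈R
        nbhd-in (r , r∈R , inj₂ ru) = X-closed (R⊆X r∈R) ru

        pre-in : ∀ {u v k} → pre u v ≡ just k → u ∈ X × v ∈ X
        pre-in eq with pre-near eq
        ... | inj₁ near = nbhd-in near , X-closed (nbhd-in near) (onEdges pre-proper eq)
        ... | inj₂ near = X-closed (nbhd-in near) (adj-sym (onEdges pre-proper eq)) , nbhd-in near

        d-proper : Proper d
        d-proper = record
          { symmetric = λ u v → cong₂ _<∣>_ (symmetric pre-proper u v) (symmetric c-proper u v)
          ; onEdges   = λ eq → [ onEdges pre-proper , onEdges c-proper ] (d-inv eq)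
          ; clashFree = λ uw w≢z eq₁ eq₂ → case (d-inv eq₁ , d-inv eq₂) of λ
            { (inj₁ p , inj₁ q) → clashFree pre-proper uw w≢z p q
            ; (inj₂ p , inj₂ q) → clashFree c-proper uw w≢z p q
            ; (inj₁ p , inj₂ q) → c-outside q (X-closed (proj₂ (pre-in p)) uw)
            ; (inj₂ p , inj₁ q) →
                c-outside (flip c-proper p) (X-closed (proj₁ (pre-in q)) (adj-sym uw)) }
          }

        d-coloured : ∀ {u v} → Adj u v → u ∉ X → v ∉ X → Coloured d u v
        d-coloured {u} {v} uv u∉X v∉X with pre u v
        ... | just k  = k , refl
        ... | nothing = coloured uv u∉X v∉X

      -- Undoing one step of the search: exactly the edges from `u` to vertices outside `X` become
      -- due, and `w`, from which `u` was reached, is a centre of each of them.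
      grown-step : ∀ {X u w} → w ∈ X → u ∉ X → Adj w u → Grown (u ∷ X) → Grown X
      grown-step {X} {u} {w} w∈X u∉X wu (c , c-proper , pre⊑c , c-support , coloured) =
        let d , ext , new = greedy Q Q? Q-sym c-proper free
        in d , proper ext , extends ext ∘ pre⊑c ,
           (λ eq → d-support (support ext eq)) , d-coloured ext new
        where
        Q : V → V → Set
        Q a b = (a ∉ X × b ∉ X) × (a ≡ u ⊎ b ≡ u)

        Q? : ∀ a b → Dec (Q a b)
        Q? a b = ((a ∉? X) ×-dec (b ∉? X)) ×-dec ((a Fin.≟ u) ⊎-dec (b Fin.≟ u))

        Q-sym : ∀ {a b} → Q a b → Q b a
        Q-sym ((a∉X , b∉X) , e) = (b∉X , a∉X) , swap e

        d-support : ∀ {a b k} → c a b ≡ just k ⊎ Q a b → pre a b ≡ just k ⊎ (a ∉ X × b ∉ X)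
        d-support (inj₂ (∉X , _)) = inj₂ ∉X
        d-support (inj₁ eq) with c-support eq
        ... | inj₁ old = inj₁ old
        ... | inj₂ (a∉ , b∉) = inj₂ (a∉ ∘ there , b∉ ∘ there)

        -- The star of w is uncoloured, except for at most two precoloured edges.
        free-u : ∀ {d} → Extends Q c d → ∀ {z} → Adj u z → z ∉ X → Colourable d u z
        free-u {d} ext {z} uz z∉X =
          let ps , ps≤2 , few = pre-few w in colourable-few-centres zs zs≤9 ps ps≤2 (covers few)
          where
          zs : List V
          zs = remove Fin._≟_ w (centres u z)

          zs≤9 : length zs ≤ 9
          zs≤9 = ≤-pred (≤-trans
            (length-remove Fin._≟_ (∈-centres (inj₁ (adj-sym wu , λ { refl → z∉X w∈X }))))
            (length-centres uz))

          covers : ∀ {ps} → (∀ {x k} → pre w x ≡ just k → k ∈ ps) → ∀ {y} → Near u z y →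
            y ∈ zs ⊎ (∀ {x k} → d y x ≡ just k → k ∈ ps)
          covers few {y} near with y Fin.≟ w
          ... | no y≢w = inj₁ (∈-remove⁺ Fin._≟_ (∈-centres near) y≢w)
          ... | yes refl = inj₂ λ eq → [ few , (λ (w∉X , _) → ⊥-elim (w∉X w∈X)) ] (d-support (support ext eq))

        free : ∀ {d} → Extends Q c d → ∀ {a b} → Adj a b → Q a b → Colourable d a b
        free ext ab ((_ , b∉X) , inj₁ refl) = free-u ext ab b∉X
        free ext ab ((a∉X , _) , inj₂ refl) = colourable-sym (free-u ext (adj-sym ab) a∉X)

        d-coloured : ∀ {d} → Extends Q c d → (∀ {a b} → Adj a b → Q a b → Coloured d a b) →
          ∀ {a b} → Adj a b → a ∉ X → b ∉ X → Coloured d a b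
        d-coloured ext new {a} {b} ab a∉X b∉X with a Fin.≟ u | b Fin.≟ u
        ... | yes a≡u | _ = new ab ((a∉X , b∉X) , inj₁ a≡u)
        ... | no _ | yes b≡u = new ab ((a∉X , b∉X) , inj₂ b≡u)
        ... | no a≢u | no b≢u =
          let k , eq = coloured ab (λ { (here a≡u) → a≢u a≡u ; (there a∈X) → a∉X a∈X })
                                   (λ { (here b≡u) → b≢u b≡u ; (there b∈X) → b∉X b∈X })
          in k , extends ext eq

      -- Two greedy rounds: the count in `pendant` relies on uncoloured edges inside `R`, so those
      -- edges wait for the second round.
      finish : Grown (R ++ W) → ColouringOutside W
      finish (c , c-proper , pre⊑c , c-support , coloured) =
        let d , ext , new = greedy Pendant Pendant? swap c-proper pendant-free
            e , ext′ , new′ = greedy Core Core? (λ (p , q) → q , p) (proper ext)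
              (λ ext′ uv (u∈R , v∈R) → core (proper ext′) (extends ext′ ∘ extends ext ∘ pre⊑c) u∈R v∈R uv)
        in e , proper ext′ , e-outside ext ext′ , e-coloured ext ext′ new new′
        where
        Pendant Core : V → V → Set
        Pendant u v = (u ∈ R × v ∉ R) ⊎ (v ∈ R × u ∉ R)
        Core u v = u ∈ R × v ∈ R

        Pendant? : ∀ u v → Dec (Pendant u v)
        Pendant? u v = ((u ∈? R) ×-dec (v ∉? R)) ⊎-dec ((v ∈? R) ×-dec (u ∉? R))

        Core? : ∀ u v → Dec (Core u v)
        Core? u v = (u ∈? R) ×-dec (v ∈? R)

        core-uncoloured : ∀ {d} → Extends Pendant c d → ∀ {u v k} → u ∈ R → v ∈ R → d u v ≢ just k
        core-uncoloured ext u∈R v∈R eq with support ext eq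
        ... | inj₂ (inj₁ (_ , v∉R)) = v∉R v∈R
        ... | inj₂ (inj₂ (_ , u∉R)) = u∉R u∈R
        ... | inj₁ cuv with c-support cuv
        ...   | inj₁ old = pre-outer u∈R v∈R old
        ...   | inj₂ (u∉ , _) = u∉ (∈-++⁺ˡ u∈R)

        pendant-free : ∀ {d} → Extends Pendant c d → ∀ {u v} → Adj u v → Pendant u v → Colourable d u v
        pendant-free ext uv (inj₁ (u∈R , v∉R)) =
          pendant (proper ext) (extends ext ∘ pre⊑c) (core-uncoloured ext) u∈R v∉R uv
        pendant-free ext uv (inj₂ (v∈R , u∉R)) = colourable-sym
          (pendant (proper ext) (extends ext ∘ pre⊑c) (core-uncoloured ext) v∈R u∉R (adj-sym uv))

        live-nbhd : ∀ {u} → Nbhd R u → u ∉ W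
        live-nbhd (r , r∈R , inj₁ refl) = live r∈R
        live-nbhd (r , r∈R , inj₂ ru) = live-adj W-closed (live r∈R) ru

        e-outside : ∀ {d e} → Extends Pendant c d → Extends Core d e →
          ∀ {u v k} → e u v ≡ just k → u ∉ W
        e-outside ext ext′ eq with support ext′ eq
        ... | inj₂ (u∈R , _) = live u∈R
        ... | inj₁ duv with support ext duv
        ...   | inj₂ (inj₁ (u∈R , _)) = live u∈R
        ...   | inj₂ (inj₂ (v∈R , _)) = live-adj W-closed (live v∈R) (adj-sym (onEdges (proper ext) duv))
        ...   | inj₁ cuv with c-support cuv
        ...     | inj₂ (u∉ , _) = u∉ ∘ ∈-++⁺ʳ R
        ...     | inj₁ old =
          [ live-nbhd
          , (λ near → live-adj W-closed (live-nbhd near) (adj-sym (onEdges pre-proper old))) ] (pre-near old)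

        ∉-++ : ∀ {u} → u ∉ R → u ∉ W → u ∉ R ++ W
        ∉-++ u∉R u∉W u∈ = [ u∉R , u∉W ] (∈-++⁻ R u∈)

        e-coloured : ∀ {d e} → Extends Pendant c d → Extends Core d e →
          (∀ {u v} → Adj u v → Pendant u v → Coloured d u v) →
          (∀ {u v} → Adj u v → Core u v → Coloured e u v) →
          ∀ {u v} → Adj u v → u ∉ W → v ∉ W → Coloured e u v
        e-coloured ext ext′ new new′ {u} {v} uv u∉W v∉W with u ∈? R | v ∈? R
        ... | yes u∈R | yes v∈R = new′ uv (u∈R , v∈R)
        ... | yes u∈R | no v∉R = let k , eq = new uv (inj₁ (u∈R , v∉R)) in k , extends ext′ eq
        ... | no u∉R | yes v∈R = let k , eq = new uv (inj₂ (v∈R , u∉R)) in k , extends ext′ eq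
        ... | no u∉R | no v∉R =
          let k , eq = coloured uv (∉-++ u∉R u∉W) (∉-++ v∉R v∉W)
          in k , extends ext′ (extends ext eq)

    -- The bound `m` stays the same only when `grow` passes a closed set to `colourOutside`. Every
    -- other call puts a new vertex into the list and lowers it.
    colourOutside : ∀ m {W} → outside W ≤ m → Closed W → ColouringOutside W
    grow : ∀ m {W} (W-closed : Closed W) (ρ : Root W) {X} → outside X ≤ m → Root.R ρ ⊆ X →
      FromRoot.Grown W-closed ρ X

    colourOutside m {W} ≤m W-closed with Fin.any? (_∉? W)
    ... | no none = ∅ , ∅-proper , (λ ()) , λ {u} _ u∉W → ⊥-elim (none (u , u∉W))
    ... | yes (v , v∉W) = split m ≤m
      where
      ρ = root W-closed v∉W
      open Root ρ
      open FromRoot W-closed ρ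

      shrinks : outside (R ++ W) < outside W
      shrinks = outside-< (∈-++⁺ʳ R) (∈-++⁺ˡ r∈R) (live r∈R)

      split : ∀ m → outside W ≤ m → ColouringOutside W
      split zero ≤m with () ← ≤-trans shrinks ≤m
      split (suc m) ≤m = finish (grow m W-closed ρ (≤-pred (≤-trans shrinks ≤m)) ∈-++⁺ˡ)

    grow m W-closed ρ {X} ≤m R⊆X
      with Fin.any? (λ w → Fin.any? λ u → (w ∈? X) ×-dec ((u ∉? X) ×-dec adj? w u))
    ... | no none = FromRoot.grown-closed W-closed ρ R⊆X X-closed (colourOutside m ≤m X-closed)
      where
      X-closed : Closed X
      X-closed {w} {u} w∈X wu =
        decidable-stable (u ∈? X) λ u∉X → none (w , u , w∈X , u∉X , wu)
    ... | yes (w , u , w∈X , u∉X , wu) = split m ≤m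
      where
      shrinks : outside (u ∷ X) < outside X
      shrinks = outside-< there (here refl) u∉X

      split : ∀ m → outside X ≤ m → FromRoot.Grown W-closed ρ X
      split zero ≤m with () ← ≤-trans shrinks ≤m
      split (suc m) ≤m = FromRoot.grown-step W-closed ρ w∈X u∉X wu
        (grow m W-closed ρ (≤-pred (≤-trans shrinks ≤m)) (there ∘ R⊆X))

  -- Roots at a vertex of low degree and at a triangle.

  lowDegreeRoot : ∀ {W v} → v ∉ W → length (N v) ≤ 5 → Root W
  lowDegreeRoot {v = v} v∉W ≤5 = record
    { R = v ∷ []
    ; r∈R = here refl
    ; live = λ { (here refl) → v∉W }
    ; pre = ∅
    ; pre-proper = ∅-proper
    ; pre-near = λ ()
    ; pre-outer = λ _ _ ()
    ; pre-few = λ _ → [] , z≤n , λ ()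
    -- An edge at `v` has at most 4 + 5 = 9 centres, hence at most 54 forbidden colours.
    ; pendant = λ { _ _ _ {v = z} (here refl) _ vz → colourable-few-nbrs (centres v z)
        (≤-trans (≤-reflexive (length-++ (N∖ v z)))
          (+-mono-≤ (≤-pred (≤-trans (length-N∖ vz) ≤5)) (length-N∖≤5 (adj-sym vz))))
        ∈-centres }
    ; core = λ { _ _ (here refl) (here refl) vv → ⊥-elim (adj-irrefl vv) }
    }

  -- The centres `s` and `t` each carry two uncoloured edges inside `R`, one back to `u` and one
  -- further on, which makes four redundant darts. In a triangle `s′` is `t` and `t′` is `s`; in a
  -- square both are the corner opposite `u`.
  colourable-pendant : ∀ {c R} → (∀ {u v k} → u ∈ R → v ∈ R → c u v ≢ just k) →
    ∀ {u s t s′ t′ v} → u ∈ R → s ∈ R → t ∈ R → s′ ∈ R → t′ ∈ R →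
    Adj u s → Adj u t → s ≢ t → Adj s s′ → Adj t t′ → s′ ≢ u → t′ ≢ u →
    v ∉ R → Adj u v → Colourable c u v
  colourable-pendant uncoloured {u} {s} {t} {s′} {t′} u∈ s∈ t∈ s′∈ t′∈ us ut s≢t ss′ tt′ s′≢u t′≢u v∉R uv =
    colourable-redundant uv ((s , u) ∷ (s , s′) ∷ (t , u) ∷ (t , t′) ∷ []) refl
      (((s′≢u ∘ sym ∘ cong proj₂) ∷ (s≢t ∘ cong proj₁) ∷ (s≢t ∘ cong proj₁) ∷ []) ∷
       ((s≢t ∘ cong proj₁) ∷ (s≢t ∘ cong proj₁) ∷ []) ∷
       ((t′≢u ∘ sym ∘ cong proj₂) ∷ []) ∷ [] ∷ [])
      ((near us s∈ , adj-sym us) ∷ (near us s∈ , ss′) ∷ (near ut t∈ , adj-sym ut) ∷ (near ut t∈ , tt′) ∷ [])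
      (inj₁ (uncoloured s∈ u∈) ∷ inj₁ (uncoloured s∈ s′∈) ∷
       inj₁ (uncoloured t∈ u∈) ∷ inj₁ (uncoloured t∈ t′∈) ∷ [])
    where
    near : ∀ {w} → Adj u w → w ∈ _ → Near u _ w
    near uw w∈R = inj₁ (uw , λ { refl → v∉R w∈R })

  -- The third vertex is a centre from both ends, so there are only 4 + 5 = 9 distinct centres.
  colourable-in-triangle : ∀ {c u v w} → Adj u v → Adj u w → Adj v w → Colourable c u v
  colourable-in-triangle {u = u} {v} {w} uv uw vw = colourable-few-nbrs (rest ++ N∖ v u)
    (≤-trans (≤-reflexive (length-++ rest))
      (+-mono-≤ (≤-pred (≤-trans (length-remove Fin._≟_ (∈N∖⁺ uw (adj⇒≢ vw ∘ sym))) (length-N∖≤5 uv)))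
        (length-N∖≤5 (adj-sym uv))))
    covers
    where
    rest : List V
    rest = remove Fin._≟_ w (N∖ u v)

    covers : ∀ {y} → Near u v y → y ∈ rest ++ N∖ v u
    covers (inj₂ (vy , y≢u)) = ∈-++⁺ʳ rest (∈N∖⁺ vy y≢u)
    covers {y} (inj₁ (uy , y≢v)) with y Fin.≟ w
    ... | yes refl = ∈-++⁺ʳ rest (∈N∖⁺ vw (adj⇒≢ uw ∘ sym))
    ... | no y≢w = ∈-++⁺ˡ (∈-remove⁺ Fin._≟_ (∈N∖⁺ uy y≢v) y≢w)

  triangleRoot : ∀ {W} → Closed W → ∀ {u v w} → u ∉ W → Adj u v → Adj v w → Adj u w → Root W
  triangleRoot closed {u} {v} {w} u∉W uv vw uw = record
    { R = u ∷ v ∷ w ∷ []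
    ; r∈R = here refl
    ; live = λ { (here refl) → u∉W
               ; (there (here refl)) → live-adj closed u∉W uv
               ; (there (there (here refl))) → live-adj closed u∉W uw }
    ; pre = ∅
    ; pre-proper = ∅-proper
    ; pre-near = λ ()
    ; pre-outer = λ _ _ ()
    ; pre-few = λ _ → [] , z≤n , λ ()
    ; pendant = λ _ _ uncoloured → λ
        { (here refl) → pend uncoloured u∈ v∈ w∈ uv vw uw
        ; (there (here refl)) → pend uncoloured v∈ u∈ w∈ (adj-sym uv) uw vw
        ; (there (there (here refl))) → pend uncoloured w∈ u∈ v∈ (adj-sym uw) uv (adj-sym vw) }
    ; core = λ _ _ → λ
        { (here refl) (here refl) e → ⊥-elim (adj-irrefl e)
        ; (here refl) (there (here refl)) _ → colourable-in-triangle uv uw vw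
        ; (here refl) (there (there (here refl))) _ → colourable-in-triangle uw uv (adj-sym vw)
        ; (there (here refl)) (here refl) _ → colourable-in-triangle (adj-sym uv) vw uw
        ; (there (here refl)) (there (here refl)) e → ⊥-elim (adj-irrefl e)
        ; (there (here refl)) (there (there (here refl))) _ →
            colourable-in-triangle vw (adj-sym uv) (adj-sym uw)
        ; (there (there (here refl))) (here refl) _ → colourable-in-triangle (adj-sym uw) (adj-sym vw) uv
        ; (there (there (here refl))) (there (here refl)) _ →
            colourable-in-triangle (adj-sym vw) (adj-sym uw) (adj-sym uv)
        ; (there (there (here refl))) (there (there (here refl))) e → ⊥-elim (adj-irrefl e) }
    }
    where
    R : List V
    R = u ∷ v ∷ w ∷ []

    u∈ : u ∈ R
    u∈ = here refl
    v∈ : v ∈ R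
    v∈ = there (here refl)
    w∈ : w ∈ R
    w∈ = there (there (here refl))

    pend : ∀ {c} → (∀ {u v k} → u ∈ R → v ∈ R → c u v ≢ just k) →
      ∀ {a b d} → a ∈ R → b ∈ R → d ∈ R → Adj a b → Adj b d → Adj a d →
      ∀ {z} → z ∉ R → Adj a z → Colourable c a z
    pend uncoloured a∈ b∈ d∈ ab bd ad = colourable-pendant uncoloured a∈ b∈ d∈ d∈ b∈ ab ad
      (adj⇒≢ bd) bd (adj-sym bd) (adj⇒≢ ad ∘ sym) (adj⇒≢ ab ∘ sym)

  -- Squares

  -- A unit between a and b makes the two opposite corners a and b of a square a x b y
  -- cost one colour less: either q = r is a further common neighbour, or the edges aq
  -- and br are not in conflict and can share a colour.
  record Unit (a b x y q r : V) : Set where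
    field
      aq    : Adj a q
      br    : Adj b r
      q≢x   : q ≢ x
      q≢y   : q ≢ y
      r≢x   : r ≢ x
      r≢y   : r ≢ y
      apart : q ≡ r ⊎ (¬ Adj q r × ¬ Adj b q × ¬ Adj a r)

  -- The last two inequalities keep the two units of `a` and `b` from saving the same dart or
  -- precolouring the same edge.
  record Config (a b x y q₁ r₁ q₂ r₂ p s : V) : Set where
    field
      ax : Adj a x
      ay : Adj a y
      bx : Adj b x
      by : Adj b y
      a≢b : a ≢ b
      x≢y : x ≢ y
      a≁b : ¬ Adj a b
      x≁y : ¬ Adj x y
      unit₁ : Unit a b x y q₁ r₁
      unit₂ : Unit a b x y q₂ r₂
      unit₃ : Unit x y a b p s
      q₁≢q₂ : q₁ ≢ q₂
      r₁≢r₂ : r₁ ≢ r₂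

  unit-flip : ∀ {a b x y q r} → Unit a b x y q r → Unit b a x y r q
  unit-flip υ = record
    { aq = br ; br = aq ; q≢x = r≢x ; q≢y = r≢y ; r≢x = q≢x ; r≢y = q≢y
    ; apart = [ inj₁ ∘ sym , (λ (q≁r , b≁q , a≁r) → inj₂ (q≁r ∘ adj-sym , a≁r , b≁q)) ] apart }
    where open Unit υ

  unit-swap : ∀ {a b x y q r} → Unit a b x y q r → Unit a b y x q r
  unit-swap υ = record
    { aq = aq ; br = br ; q≢x = q≢y ; q≢y = q≢x ; r≢x = r≢y ; r≢y = r≢x ; apart = apart }
    where open Unit υ

  -- Together with `config-swap` this symmetry carries every side of the square to `ax`, so only
  -- that side has to be counted.
  config-flip : ∀ {a b x y q₁ r₁ q₂ r₂ p s} →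
    Config a b x y q₁ r₁ q₂ r₂ p s → Config b a x y r₁ q₁ r₂ q₂ p s
  config-flip κ = record
    { ax = bx ; ay = by ; bx = ax ; by = ay ; a≢b = a≢b ∘ sym ; x≢y = x≢y
    ; a≁b = a≁b ∘ adj-sym ; x≁y = x≁y
    ; unit₁ = unit-flip unit₁ ; unit₂ = unit-flip unit₂ ; unit₃ = unit-swap unit₃
    ; q₁≢q₂ = r₁≢r₂ ; r₁≢r₂ = q₁≢q₂ }
    where open Config κ

  config-swap : ∀ {a b x y q₁ r₁ q₂ r₂ p s} →
    Config a b x y q₁ r₁ q₂ r₂ p s → Config a b y x q₁ r₁ q₂ r₂ s p
  config-swap κ = record
    { ax = ay ; ay = ax ; bx = by ; by = bx ; a≢b = a≢b ; x≢y = x≢y ∘ sym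
    ; a≁b = a≁b ; x≁y = x≁y ∘ adj-sym
    ; unit₁ = unit-swap unit₁ ; unit₂ = unit-swap unit₂ ; unit₃ = unit-flip unit₃
    ; q₁≢q₂ = q₁≢q₂ ; r₁≢r₂ = r₁≢r₂ }
    where open Config κ

  -- The saving of a unit as it shows in a colouring; it persists under extension.
  record Linked (c : Colouring) (a b q r : V) : Set where
    constructor linked
    field
      link : q ≡ r ⊎ ∃ λ k → c a q ≡ just k × c b r ≡ just k

  linked-flip : ∀ {c a b q r} → Linked c a b q r → Linked c b a r q
  linked-flip (linked (inj₁ q≡r)) = linked (inj₁ (sym q≡r))
  linked-flip (linked (inj₂ (k , p , q))) = linked (inj₂ (k , q , p))

  linked-⊑ : ∀ {c d a b q r} → c ⊑ d → Linked c a b q r → Linked d a b q r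
  linked-⊑ c⊑d (linked (inj₁ q≡r)) = linked (inj₁ q≡r)
  linked-⊑ c⊑d (linked (inj₂ (k , p , q))) = linked (inj₂ (k , c⊑d p , c⊑d q))

  -- This is what makes the dart `(b , r)` redundant: its colour also appears at the centre `q`, on
  -- `qb` if `q` is `r` and on `qa` if the two edges share a colour.
  linked-dart : ∀ {c a b x y q r} → Proper c → Unit a b x y q r → Linked c a b q r →
    ∃ λ z → Adj q z × c q z ≡ c b r
  linked-dart {b = b} {q = q} proper υ (linked (inj₁ refl)) = b , adj-sym (Unit.br υ) , symmetric proper q b
  linked-dart {a = a} {q = q} proper υ (linked (inj₂ (k , p , r))) =
    a , adj-sym (Unit.aq υ) , trans (symmetric proper q a) (trans p (sym r))

  -- Four darts are saved for the side `ax`: `(b , y)` is also counted as `(y , b)`, the colours of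
  -- `(b , r₁)` and `(b , r₂)` reappear at `q₁` and `q₂`, and that of `(y , s)` at `p`.
  colourable-square : ∀ {c a b x y q₁ r₁ q₂ r₂ p s} → Proper c →
    Config a b x y q₁ r₁ q₂ r₂ p s →
    Linked c a b q₁ r₁ → Linked c a b q₂ r₂ → Linked c x y p s → Colourable c a x
  colourable-square {c} {a} {b} {x} {y} {q₁} {r₁} {q₂} {r₂} {p} {s} proper κ link₁ link₂ link₃ =
    colourable-redundant ax rs refl
      (((U₁.r≢y ∘ sym ∘ cong proj₂) ∷ (U₂.r≢y ∘ sym ∘ cong proj₂) ∷ (adj⇒≢ by ∘ cong proj₁) ∷ []) ∷
       ((r₁≢r₂ ∘ cong proj₂) ∷ (adj⇒≢ by ∘ cong proj₁) ∷ []) ∷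
       ((adj⇒≢ by ∘ cong proj₁) ∷ []) ∷ [] ∷ [])
      ((near-b , by) ∷ (near-b , U₁.br) ∷ (near-b , U₂.br) ∷ (inj₁ (ay , x≢y ∘ sym) , U₃.br) ∷ [])
      (inj₂ ((y , b) , (inj₁ (ay , x≢y ∘ sym) , adj-sym by) ,
         ∉rs (adj⇒≢ by ∘ sym) (inj₂ (U₃.r≢y ∘ sym)) , symmetric proper y b) ∷
       redundant unit₁ link₁ ∷ redundant unit₂ link₂ ∷ redundant₃ ∷ [])
    where
    open Config κ
    module U₁ = Unit unit₁
    module U₂ = Unit unit₂
    module U₃ = Unit unit₃

    rs : List (V × V)
    rs = (b , y) ∷ (b , r₁) ∷ (b , r₂) ∷ (y , s) ∷ []

    near-b : Near a x b
    near-b = inj₂ (adj-sym bx , a≢b ∘ sym)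

    ∉rs : ∀ {w z} → w ≢ b → w ≢ y ⊎ z ≢ s → (w , z) ∉ rs
    ∉rs w≢b _ (here refl) = w≢b refl
    ∉rs w≢b _ (there (here refl)) = w≢b refl
    ∉rs w≢b _ (there (there (here refl))) = w≢b refl
    ∉rs _ (inj₁ w≢y) (there (there (there (here refl)))) = w≢y refl
    ∉rs _ (inj₂ z≢s) (there (there (there (here refl)))) = z≢s refl

    redundant : ∀ {q r} → Unit a b x y q r → Linked c a b q r → Redundant c a x rs (b , r)
    redundant {q} υ link =
      let z , qz , same = linked-dart proper υ link
      in inj₂ ((q , z) , (inj₁ (Unit.aq υ , Unit.q≢x υ) , qz) ,
           ∉rs (λ { refl → a≁b (Unit.aq υ) }) (inj₁ (Unit.q≢y υ)) , same)

    redundant₃ : Redundant c a x rs (y , s)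
    redundant₃ =
      let z , pz , same = linked-dart proper unit₃ link₃
      in inj₂ ((p , z) , (inj₂ (U₃.aq , U₃.q≢x) , pz) ,
           ∉rs U₃.q≢y (inj₁ λ { refl → x≁y U₃.aq }) , same)

  Stub : V → V → V → V → V → V → Set
  Stub a b q r u v = Same u v a q ⊎ Same u v b r

  paint-unit : ∀ {a b x y q r} k → Unit a b x y q r → a ≢ b → ¬ Adj a b →
    ∀ {c} → Proper c → (∀ {u v} → c u v ≢ just k) →
    (∀ {j} → c a q ≢ just j) → (∀ {j} → c b r ≢ just j) →
    ∃ λ d → Proper d × c ⊑ d × Linked d a b q r ×
      (∀ {u v j} → d u v ≡ just j → c u v ≡ just j ⊎ (j ≡ k × Stub a b q r u v))
  paint-unit {a} {b} {q = q} {r} k υ a≢b a≁b {c} proper unused caq cbr with Unit.apart υ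
  ... | inj₁ q≡r = c , proper , id , linked (inj₁ q≡r) , inj₁
  ... | inj₂ (q≁r , b≁q , a≁r) =
    e , paint-proper d-proper br free , c⊑d-e ,
    linked (inj₂ (k , paint-⊑ d-proper dbr (paint-new (inj₁ (refl , refl))) , paint-new (inj₁ (refl , refl)))) ,
    λ eq → case paint-inv eq of λ
      { (inj₁ (same , j≡k)) → inj₂ (j≡k , inj₂ same)
      ; (inj₂ eq′) → case paint-inv eq′ of λ
        { (inj₁ (same , j≡k)) → inj₂ (j≡k , inj₁ same)
        ; (inj₂ old) → inj₁ old } }
    where
    open Unit υ
    d e : Colouring
    d = paint a q k c
    e = paint b r k d

    d-proper : Proper d
    d-proper = paint-proper proper aq λ _ _ → unused

    dbr : ∀ {j} → d b r ≢ just j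
    dbr eq with paint-inv eq
    ... | inj₁ (inj₁ (b≡a , _) , _) = a≢b (sym b≡a)
    ... | inj₁ (inj₂ (refl , _) , _) = a≁b aq
    ... | inj₂ old = cbr old

    c⊑d-e : c ⊑ e
    c⊑d-e eq = paint-⊑ d-proper dbr (paint-⊑ proper caq eq)

    free : Free d b r k
    free near _ eq with paint-inv eq
    ... | inj₂ old = unused old
    ... | inj₁ (inj₁ (refl , _) , _) =
      [ (λ (ba , _) → a≁b (adj-sym ba)) , (λ (ra , _) → a≁r (adj-sym ra)) ] near
    ... | inj₁ (inj₂ (refl , _) , _) =
      [ (λ (bq , _) → b≁q bq) , (λ (rq , _) → q≁r (adj-sym rq)) ] near

  module SquareRoot {W} (closed : Closed W)
    (triangle-free : ∀ {u v w} → u ∉ W → Adj u v → Adj v w → Adj u w → ⊥)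
    {a b x y q₁ r₁ q₂ r₂ p s : V} (a∉W : a ∉ W) (κ : Config a b x y q₁ r₁ q₂ r₂ p s) where

    open Config κ
    module U₁ = Unit unit₁
    module U₂ = Unit unit₂
    module U₃ = Unit unit₃

    x∉W : x ∉ W
    x∉W = live-adj closed a∉W ax
    y∉W : y ∉ W
    y∉W = live-adj closed a∉W ay
    b∉W : b ∉ W
    b∉W = live-adj closed x∉W (adj-sym bx)

    R : List V
    R = a ∷ b ∷ x ∷ y ∷ []

    a∈ : a ∈ R
    a∈ = here refl
    b∈ : b ∈ R
    b∈ = there (here refl)
    x∈ : x ∈ R
    x∈ = there (there (here refl))
    y∈ : y ∈ R
    y∈ = there (there (there (here refl)))

    -- The ends {a, b, q₁, q₂, r₁, r₂} of the edges precoloured k₀ or k₁ are disjoint from those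
    -- precoloured k₂, hence no vertex meets three precoloured edges.
    Side : V → Set
    Side w = (w ≢ x × w ≢ y) × (w ≡ a ⊎ w ≡ b ⊎ Adj a w ⊎ Adj b w)

    side-stub : ∀ {q r} → Unit a b x y q r → ∀ {u v} → Stub a b q r u v → Side u
    side-stub υ (inj₁ (inj₁ (refl , _))) = (adj⇒≢ ax , adj⇒≢ ay) , inj₁ refl
    side-stub υ (inj₁ (inj₂ (refl , _))) = (Unit.q≢x υ , Unit.q≢y υ) , inj₂ (inj₂ (inj₁ (Unit.aq υ)))
    side-stub υ (inj₂ (inj₁ (refl , _))) = (adj⇒≢ bx , adj⇒≢ by) , inj₂ (inj₁ refl)
    side-stub υ (inj₂ (inj₂ (refl , _))) = (Unit.r≢x υ , Unit.r≢y υ) , inj₂ (inj₂ (inj₂ (Unit.br υ)))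

    -- If `p` or `s` were adjacent to `a` or `b`, it would close a triangle with `x` or `y`.
    side-¬stub₃ : ∀ {u v} → Side u → ¬ Stub x y p s u v
    side-¬stub₃ ((u≢x , _) , _) (inj₁ (inj₁ (u≡x , _))) = u≢x u≡x
    side-¬stub₃ ((_ , u≢y) , _) (inj₂ (inj₁ (u≡y , _))) = u≢y u≡y
    side-¬stub₃ (_ , inj₁ refl) (inj₁ (inj₂ (a≡p , _))) = U₃.q≢x (sym a≡p)
    side-¬stub₃ (_ , inj₂ (inj₁ refl)) (inj₁ (inj₂ (b≡p , _))) = U₃.q≢y (sym b≡p)
    side-¬stub₃ (_ , inj₂ (inj₂ (inj₁ au))) (inj₁ (inj₂ (refl , _))) = triangle-free a∉W ax U₃.aq au
    side-¬stub₃ (_ , inj₂ (inj₂ (inj₂ bu))) (inj₁ (inj₂ (refl , _))) = triangle-free b∉W bx U₃.aq bu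
    side-¬stub₃ (_ , inj₁ refl) (inj₂ (inj₂ (a≡s , _))) = U₃.r≢x (sym a≡s)
    side-¬stub₃ (_ , inj₂ (inj₁ refl)) (inj₂ (inj₂ (b≡s , _))) = U₃.r≢y (sym b≡s)
    side-¬stub₃ (_ , inj₂ (inj₂ (inj₁ au))) (inj₂ (inj₂ (refl , _))) = triangle-free a∉W ay U₃.br au
    side-¬stub₃ (_ , inj₂ (inj₂ (inj₂ bu))) (inj₂ (inj₂ (refl , _))) = triangle-free b∉W by U₃.br bu

    -- One colour per unit, so that different units cannot clash.
    k₀ k₁ k₂ : Fin 57
    k₀ = zero
    k₁ = suc zero
    k₂ = suc (suc zero)

    Stubs : V → V → Fin 57 → Set
    Stubs u v k = k ≡ k₀ × Stub a b q₁ r₁ u v ⊎ k ≡ k₁ × Stub a b q₂ r₂ u v ⊎ k ≡ k₂ × Stub x y p s u v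

    record Precolouring : Set where
      field
        pre     : Colouring
        proper′ : Proper pre
        link₁   : Linked pre a b q₁ r₁
        link₂   : Linked pre a b q₂ r₂
        link₃   : Linked pre x y p s
        stubs   : ∀ {u v k} → pre u v ≡ just k → Stubs u v k

    precolouring : Precolouring
    precolouring =
      let c₁ , proper₁ , _ , link₁ , support₁ =
            paint-unit k₀ unit₁ a≢b a≁b ∅-proper (λ ()) (λ ()) (λ ())
          stubs₁ : ∀ {u v k} → c₁ u v ≡ just k → k ≡ k₀ × Stub a b q₁ r₁ u v
          stubs₁ eq = [ (λ ()) , id ] (support₁ eq)
          -- Nothing is overwritten: the units of `a` and `b` use different edges, and those of the
          -- third unit have no end in common with either.
          c₂ , proper₂ , c₁⊑c₂ , link₂ , support₂ =
            paint-unit k₁ unit₂ a≢b a≁b proper₁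
              (λ eq → case proj₁ (stubs₁ eq) of λ ())
              (λ eq → ¬stub₁-a (proj₂ (stubs₁ eq)))
              (λ eq → ¬stub₁-b (proj₂ (stubs₁ eq)))
          stubs₂ : ∀ {u v k} → c₂ u v ≡ just k →
            k ≡ k₀ × Stub a b q₁ r₁ u v ⊎ k ≡ k₁ × Stub a b q₂ r₂ u v
          stubs₂ eq = map₁ stubs₁ (support₂ eq)
          c₃ , proper₃ , c₂⊑c₃ , link₃ , support₃ =
            paint-unit k₂ unit₃ x≢y x≁y proper₂
              (λ eq → [ (λ { (() , _) }) , (λ { (() , _) }) ] (stubs₂ eq))
              (λ eq → side-¬stub₃ (side₂ (stubs₂ eq)) (inj₁ (inj₁ (refl , refl))))
              (λ eq → side-¬stub₃ (side₂ (stubs₂ eq)) (inj₂ (inj₁ (refl , refl))))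
      in record
        { pre     = c₃
        ; proper′ = proper₃
        ; link₁   = linked-⊑ c₂⊑c₃ (linked-⊑ c₁⊑c₂ link₁)
        ; link₂   = linked-⊑ c₂⊑c₃ link₂
        ; link₃   = link₃
        ; stubs   = λ eq → [ map₂ inj₁ ∘ stubs₂ , inj₂ ∘ inj₂ ] (support₃ eq)
        }
      where
      ¬stub₁-a : ¬ Stub a b q₁ r₁ a q₂
      ¬stub₁-a (inj₁ (inj₁ (_ , q₂≡q₁))) = q₁≢q₂ (sym q₂≡q₁)
      ¬stub₁-a (inj₁ (inj₂ (a≡q₁ , _))) = adj⇒≢ U₁.aq a≡q₁
      ¬stub₁-a (inj₂ (inj₁ (a≡b , _))) = a≢b a≡b
      ¬stub₁-a (inj₂ (inj₂ (refl , _))) = a≁b (adj-sym U₁.br)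

      ¬stub₁-b : ¬ Stub a b q₁ r₁ b r₂
      ¬stub₁-b (inj₁ (inj₁ (b≡a , _))) = a≢b (sym b≡a)
      ¬stub₁-b (inj₁ (inj₂ (refl , _))) = a≁b U₁.aq
      ¬stub₁-b (inj₂ (inj₁ (_ , r₂≡r₁))) = r₁≢r₂ (sym r₂≡r₁)
      ¬stub₁-b (inj₂ (inj₂ (b≡r₁ , _))) = adj⇒≢ U₁.br b≡r₁

      side₂ : ∀ {u v k} → k ≡ k₀ × Stub a b q₁ r₁ u v ⊎ k ≡ k₁ × Stub a b q₂ r₂ u v → Side u
      side₂ (inj₁ (_ , stub)) = side-stub unit₁ stub
      side₂ (inj₂ (_ , stub)) = side-stub unit₂ stub

    open Precolouring precolouring

    unit-∉R : ∀ {q r} → Unit a b x y q r → q ∉ R × r ∉ R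
    unit-∉R υ =
      (λ { (here refl) → adj-irrefl aq ; (there (here refl)) → a≁b aq
         ; (there (there (here refl))) → q≢x refl ; (there (there (there (here refl)))) → q≢y refl }) ,
      (λ { (here refl) → a≁b (adj-sym br) ; (there (here refl)) → adj-irrefl br
         ; (there (there (here refl))) → r≢x refl ; (there (there (there (here refl)))) → r≢y refl })
      where open Unit υ

    unit₃-∉R : p ∉ R × s ∉ R
    unit₃-∉R =
      (λ { (here refl) → U₃.q≢x refl ; (there (here refl)) → U₃.q≢y refl
         ; (there (there (here refl))) → adj-irrefl U₃.aq ; (there (there (there (here refl)))) → x≁y U₃.aq }) ,
      (λ { (here refl) → U₃.r≢x refl ; (there (here refl)) → U₃.r≢y refl
         ; (there (there (here refl))) → x≁y (adj-sym U₃.br) ; (there (there (there (here refl)))) → adj-irrefl U₃.br })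

    stub-near : ∀ {a b q r u v} → a ∈ R → b ∈ R → Stub a b q r u v → Nbhd R u ⊎ Nbhd R v
    stub-near a∈ b∈ (inj₁ (inj₁ (refl , _))) = inj₁ (_ , a∈ , inj₁ refl)
    stub-near a∈ b∈ (inj₁ (inj₂ (_ , refl))) = inj₂ (_ , a∈ , inj₁ refl)
    stub-near a∈ b∈ (inj₂ (inj₁ (refl , _))) = inj₁ (_ , b∈ , inj₁ refl)
    stub-near a∈ b∈ (inj₂ (inj₂ (_ , refl))) = inj₂ (_ , b∈ , inj₁ refl)

    stub-outer : ∀ {a b q r u v} → q ∉ R × r ∉ R → u ∈ R → v ∈ R → ¬ Stub a b q r u v
    stub-outer (q∉ , _) _ v∈ (inj₁ (inj₁ (_ , refl))) = q∉ v∈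
    stub-outer (q∉ , _) u∈ _ (inj₁ (inj₂ (refl , _))) = q∉ u∈
    stub-outer (_ , r∉) _ v∈ (inj₂ (inj₁ (_ , refl))) = r∉ v∈
    stub-outer (_ , r∉) u∈ _ (inj₂ (inj₂ (refl , _))) = r∉ u∈

    stub₃ : ∀ {w} → w ∈ x ∷ y ∷ p ∷ s ∷ [] → ∃ (Stub x y p s w)
    stub₃ (here refl) = p , inj₁ (inj₁ (refl , refl))
    stub₃ (there (here refl)) = s , inj₂ (inj₁ (refl , refl))
    stub₃ (there (there (here refl))) = x , inj₁ (inj₂ (refl , refl))
    stub₃ (there (there (there (here refl)))) = y , inj₂ (inj₂ (refl , refl))

    few : ∀ w → ∃ λ ps → length ps ≤ 2 × (∀ {z k} → pre w z ≡ just k → k ∈ ps)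
    few w with w ∈? (x ∷ y ∷ p ∷ s ∷ [])
    ... | yes w∈ = k₂ ∷ [] , s≤s z≤n , λ eq → here (only-k₂ (stubs eq))
      where
      only-k₂ : ∀ {z k} → Stubs w z k → k ≡ k₂
      only-k₂ (inj₁ (_ , stub)) = ⊥-elim (side-¬stub₃ (side-stub unit₁ stub) (proj₂ (stub₃ w∈)))
      only-k₂ (inj₂ (inj₁ (_ , stub))) = ⊥-elim (side-¬stub₃ (side-stub unit₂ stub) (proj₂ (stub₃ w∈)))
      only-k₂ (inj₂ (inj₂ (k≡ , _))) = k≡
    ... | no w∉ = k₀ ∷ k₁ ∷ [] , s≤s (s≤s z≤n) , λ eq → not-k₂ (stubs eq)
      where
      not-k₂ : ∀ {z k} → Stubs w z k → k ∈ k₀ ∷ k₁ ∷ []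
      not-k₂ (inj₁ (k≡ , _)) = here k≡
      not-k₂ (inj₂ (inj₁ (k≡ , _))) = there (here k≡)
      not-k₂ (inj₂ (inj₂ (_ , inj₁ (inj₁ (w≡x , _))))) = ⊥-elim (w∉ (here w≡x))
      not-k₂ (inj₂ (inj₂ (_ , inj₁ (inj₂ (w≡p , _))))) = ⊥-elim (w∉ (there (there (here w≡p))))
      not-k₂ (inj₂ (inj₂ (_ , inj₂ (inj₁ (w≡y , _))))) = ⊥-elim (w∉ (there (here w≡y)))
      not-k₂ (inj₂ (inj₂ (_ , inj₂ (inj₂ (w≡s , _))))) = ⊥-elim (w∉ (there (there (there (here w≡s)))))

    squarePendant : ∀ {c} → (∀ {u v k} → u ∈ R → v ∈ R → c u v ≢ just k) →
      ∀ {u v} → u ∈ R → v ∉ R → Adj u v → Colourable c u v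
    squarePendant uncoloured (here refl) =
      colourable-pendant uncoloured a∈ x∈ y∈ b∈ b∈ ax ay x≢y (adj-sym bx) (adj-sym by) (a≢b ∘ sym) (a≢b ∘ sym)
    squarePendant uncoloured (there (here refl)) =
      colourable-pendant uncoloured b∈ x∈ y∈ a∈ a∈ bx by x≢y (adj-sym ax) (adj-sym ay) a≢b a≢b
    squarePendant uncoloured (there (there (here refl))) =
      colourable-pendant uncoloured x∈ a∈ b∈ y∈ y∈ (adj-sym ax) (adj-sym bx) a≢b ay by (x≢y ∘ sym) (x≢y ∘ sym)
    squarePendant uncoloured (there (there (there (here refl)))) =
      colourable-pendant uncoloured y∈ a∈ b∈ x∈ x∈ (adj-sym ay) (adj-sym by) a≢b ax bx x≢y x≢y

    module _ {c} (c-proper : Proper c) (pre⊑c : pre ⊑ c) where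

      colourable-ax : Colourable c a x
      colourable-ax = colourable-square c-proper κ
        (linked-⊑ pre⊑c link₁) (linked-⊑ pre⊑c link₂) (linked-⊑ pre⊑c link₃)

      colourable-ay : Colourable c a y
      colourable-ay = colourable-square c-proper (config-swap κ)
        (linked-⊑ pre⊑c link₁) (linked-⊑ pre⊑c link₂) (linked-flip (linked-⊑ pre⊑c link₃))

      colourable-bx : Colourable c b x
      colourable-bx = colourable-square c-proper (config-flip κ)
        (linked-flip (linked-⊑ pre⊑c link₁)) (linked-flip (linked-⊑ pre⊑c link₂)) (linked-⊑ pre⊑c link₃)

      colourable-by : Colourable c b y
      colourable-by = colourable-square c-proper (config-swap (config-flip κ))
        (linked-flip (linked-⊑ pre⊑c link₁)) (linked-flip (linked-⊑ pre⊑c link₂))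
        (linked-flip (linked-⊑ pre⊑c link₃))

      squareCore : ∀ {u v} → u ∈ R → v ∈ R → Adj u v → Colourable c u v
      squareCore (here refl) (here refl) e = ⊥-elim (adj-irrefl e)
      squareCore (here refl) (there (here refl)) e = ⊥-elim (a≁b e)
      squareCore (here refl) (there (there (here refl))) _ = colourable-ax
      squareCore (here refl) (there (there (there (here refl)))) _ = colourable-ay
      squareCore (there (here refl)) (here refl) e = ⊥-elim (a≁b (adj-sym e))
      squareCore (there (here refl)) (there (here refl)) e = ⊥-elim (adj-irrefl e)
      squareCore (there (here refl)) (there (there (here refl))) _ = colourable-bx
      squareCore (there (here refl)) (there (there (there (here refl)))) _ = colourable-by
      squareCore (there (there (here refl))) (here refl) _ = colourable-sym colourable-ax
      squareCore (there (there (here refl))) (there (here refl)) _ = colourable-sym colourable-bx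
      squareCore (there (there (here refl))) (there (there (here refl))) e = ⊥-elim (adj-irrefl e)
      squareCore (there (there (here refl))) (there (there (there (here refl)))) e = ⊥-elim (x≁y e)
      squareCore (there (there (there (here refl)))) (here refl) _ = colourable-sym colourable-ay
      squareCore (there (there (there (here refl)))) (there (here refl)) _ = colourable-sym colourable-by
      squareCore (there (there (there (here refl)))) (there (there (here refl))) e = ⊥-elim (x≁y (adj-sym e))
      squareCore (there (there (there (here refl)))) (there (there (there (here refl)))) e = ⊥-elim (adj-irrefl e)

    squareRoot : Root W
    squareRoot = record
      { R = R
      ; r∈R = a∈
      ; live = λ { (here refl) → a∉W ; (there (here refl)) → b∉W
                 ; (there (there (here refl))) → x∉W ; (there (there (there (here refl)))) → y∉W }
      ; pre = pre
      ; pre-proper = proper′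
      ; pre-near = λ eq → case stubs eq of λ
          { (inj₁ (_ , stub)) → stub-near a∈ b∈ stub
          ; (inj₂ (inj₁ (_ , stub))) → stub-near a∈ b∈ stub
          ; (inj₂ (inj₂ (_ , stub))) → stub-near x∈ y∈ stub }
      ; pre-outer = λ u∈ v∈ eq → case stubs eq of λ
          { (inj₁ (_ , stub)) → stub-outer (unit-∉R unit₁) u∈ v∈ stub
          ; (inj₂ (inj₁ (_ , stub))) → stub-outer (unit-∉R unit₂) u∈ v∈ stub
          ; (inj₂ (inj₂ (_ , stub))) → stub-outer unit₃-∉R u∈ v∈ stub }
      ; pre-few = few
      ; pendant = λ _ _ → squarePendant
      ; core = squareCore
      }

  -- Common neighbours and the search for a square with three units.

  C : V → V → List V
  C a b = filter (adj? b) (N a)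

  ∈C⁺ : ∀ {a b v} → Adj a v → Adj b v → v ∈ C a b
  ∈C⁺ {b = b} av bv = ∈-filter⁺ (adj? b) (∈N⁺ av) bv

  ∈C⁻ : ∀ {a b v} → v ∈ C a b → Adj a v × Adj b v
  ∈C⁻ {a} {b} v∈C = let v∈N , bv = ∈-filter⁻ (adj? b) {xs = N a} v∈C in ∈N⁻ v∈N , bv

  C-escapes : ∀ {a b} ys → length ys < length (C a b) → ∃ λ v → Adj a v × Adj b v × v ∉ ys
  C-escapes {a} {b} ys ys< =
    let v , v∈C , v∉ys = Unique-escapes Fin._≟_ (filter⁺ (adj? b) (N-unique a)) ys ys<
        av , bv = ∈C⁻ v∈C
    in v , av , bv , v∉ys

  C-⊇ : ∀ {a b} {vs : List V} → Unique vs → All (λ v → Adj a v × Adj b v) vs → length vs ≤ length (C a b)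
  C-⊇ uniq common = Unique-⊆⇒length≤ Fin._≟_ uniq λ v∈vs → uncurry ∈C⁺ (All.lookup common v∈vs)

  unit? : ∀ a b x y q r → Dec (Unit a b x y q r)
  unit? a b x y q r =
    map′ (λ ((aq , br) , (q≢x , q≢y) , (r≢x , r≢y) , apart) → record
           { aq = aq ; br = br ; q≢x = q≢x ; q≢y = q≢y ; r≢x = r≢x ; r≢y = r≢y ; apart = apart })
         (λ υ → let open Unit υ in (aq , br) , (q≢x , q≢y) , (r≢x , r≢y) , apart)
         ((adj? a q ×-dec adj? b r) ×-dec
          ((¬? (q Fin.≟ x) ×-dec ¬? (q Fin.≟ y)) ×-dec
           ((¬? (r Fin.≟ x) ×-dec ¬? (r Fin.≟ y)) ×-dec
            ((q Fin.≟ r) ⊎-dec (¬? (adj? q r) ×-dec (¬? (adj? b q) ×-dec ¬? (adj? a r)))))))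

  commonUnit : ∀ {a b x y q} → Adj a q → Adj b q → q ≢ x → q ≢ y → Unit a b x y q q
  commonUnit aq bq q≢x q≢y = record
    { aq = aq ; br = bq ; q≢x = q≢x ; q≢y = q≢y ; r≢x = q≢x ; r≢y = q≢y ; apart = inj₁ refl }

  module Regular {W} (closed : Closed W) (six : ∀ {v} → v ∉ W → 6 ≤ length (N v))
    (triangle-free : ∀ {u v w} → u ∉ W → Adj u v → Adj v w → Adj u w → ⊥) where

    N-escapes : ∀ {v} → v ∉ W → ∀ ys → length ys ≤ 5 → ∃ λ w → Adj v w × w ∉ ys
    N-escapes {v} v∉W ys ≤5 =
      let w , w∈N , w∉ys = Unique-escapes Fin._≟_ (N-unique v) ys (≤-trans (s≤s ≤5) (six v∉W))
      in w , ∈N⁻ w∈N , w∉ys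

    record Square (a b x y : V) : Set where
      field
        a∉W : a ∉ W
        ax  : Adj a x
        ay  : Adj a y
        bx  : Adj b x
        by  : Adj b y
        a≢b : a ≢ b
        x≢y : x ≢ y

      x∉W : x ∉ W
      x∉W = live-adj closed a∉W ax
      y∉W : y ∉ W
      y∉W = live-adj closed a∉W ay
      b∉W : b ∉ W
      b∉W = live-adj closed x∉W (adj-sym bx)

      a≁b : ¬ Adj a b
      a≁b ab = triangle-free a∉W ab bx ax
      x≁y : ¬ Adj x y
      x≁y xy = triangle-free a∉W ax xy ay

      a-nbr≢b : ∀ {q} → Adj a q → q ≢ b
      a-nbr≢b aq refl = a≁b aq
      b-nbr≢a : ∀ {r} → Adj b r → r ≢ a
      b-nbr≢a br refl = a≁b (adj-sym br)

    square-transpose : ∀ {a b x y} → Square a b x y → Square x y a b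
    square-transpose σ = record
      { a∉W = x∉W ; ax = adj-sym ax ; ay = adj-sym bx ; bx = adj-sym ay ; by = adj-sym by
      ; a≢b = x≢y ; x≢y = a≢b }
      where open Square σ

    configRoot : ∀ {a b x y q₁ r₁ q₂ r₂ p s} → Square a b x y →
      Unit a b x y q₁ r₁ → Unit a b x y q₂ r₂ → q₁ ≢ q₂ → r₁ ≢ r₂ → Unit x y a b p s → Root W
    configRoot σ υ₁ υ₂ q₁≢q₂ r₁≢r₂ υ₃ = SquareRoot.squareRoot closed triangle-free a∉W record
      { ax = ax ; ay = ay ; bx = bx ; by = by ; a≢b = a≢b ; x≢y = x≢y ; a≁b = a≁b ; x≁y = x≁y
      ; unit₁ = υ₁ ; unit₂ = υ₂ ; unit₃ = υ₃ ; q₁≢q₂ = q₁≢q₂ ; r₁≢r₂ = r₁≢r₂ }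
      where open Square σ

    module _ {a b x y} (σ : Square a b x y) where
      open Square σ

      -- If x and y have no unit, then their other neighbours span a complete bipartite
      -- graph, in which every further square has plenty of common neighbours.
      no-unit-root : (∀ {p s} → ¬ Unit x y a b p s) → Root W
      no-unit-root no-unit =
        let p₁ , xp₁ , p₁∉ = N-escapes x∉W (a ∷ b ∷ []) (m≤n⇒m≤o+n 3 ≤-refl)
            p₂ , xp₂ , p₂∉ = N-escapes x∉W (a ∷ b ∷ p₁ ∷ []) (m≤n⇒m≤o+n 2 ≤-refl)
            p₃ , xp₃ , p₃∉ = N-escapes x∉W (a ∷ b ∷ p₁ ∷ p₂ ∷ []) (m≤n⇒m≤o+n 1 ≤-refl)
            s₁ , ys₁ , s₁∉ = N-escapes y∉W (a ∷ b ∷ []) (m≤n⇒m≤o+n 3 ≤-refl)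
            s₂ , ys₂ , s₂∉ = N-escapes y∉W (a ∷ b ∷ s₁ ∷ []) (m≤n⇒m≤o+n 2 ≤-refl)
            s₃ , ys₃ , s₃∉ = N-escapes y∉W (a ∷ b ∷ s₁ ∷ s₂ ∷ []) (m≤n⇒m≤o+n 1 ≤-refl)
            p₁≢ = p₁∉ ∘ here , p₁∉ ∘ there ∘ here
            p₂≢ = p₂∉ ∘ here , p₂∉ ∘ there ∘ here
            p₃≢ = p₃∉ ∘ here , p₃∉ ∘ there ∘ here
            s₁≢ = s₁∉ ∘ here , s₁∉ ∘ there ∘ here
            s₂≢ = s₂∉ ∘ here , s₂∉ ∘ there ∘ here
            s₃≢ = s₃∉ ∘ here , s₃∉ ∘ there ∘ here
        -- The new square is `p₁ x p₂ s₁`. Its units are the common neighbours `s₂` and `s₃` of `p₁`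
        -- and `p₂`, and the common neighbour `p₃` of `x` and `s₁`.
        in configRoot
          (record
            { a∉W = live-adj closed x∉W xp₁
            ; ax = adj-sym xp₁ ; ay = complete xp₁ p₁≢ ys₁ s₁≢
            ; bx = adj-sym xp₂ ; by = complete xp₂ p₂≢ ys₁ s₁≢
            ; a≢b = p₂∉ ∘ there ∘ there ∘ here ∘ sym ; x≢y = ≢x ys₁ ∘ sym })
          (commonUnit (complete xp₁ p₁≢ ys₂ s₂≢) (complete xp₂ p₂≢ ys₂ s₂≢) (≢x ys₂)
            (s₂∉ ∘ there ∘ there ∘ here))
          (commonUnit (complete xp₁ p₁≢ ys₃ s₃≢) (complete xp₂ p₂≢ ys₃ s₃≢) (≢x ys₃)
            (s₃∉ ∘ there ∘ there ∘ here))
          (s₃∉ ∘ there ∘ there ∘ there ∘ here ∘ sym)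
          (s₃∉ ∘ there ∘ there ∘ there ∘ here ∘ sym)
          (commonUnit xp₃ (adj-sym (complete xp₃ p₃≢ ys₁ s₁≢))
            (p₃∉ ∘ there ∘ there ∘ here) (p₃∉ ∘ there ∘ there ∘ there ∘ here))
        where
        ≢x : ∀ {s} → Adj y s → s ≢ x
        ≢x ys refl = x≁y (adj-sym ys)

        complete : ∀ {p s} → Adj x p → p ≢ a × p ≢ b → Adj y s → s ≢ a × s ≢ b → Adj p s
        complete {p} {s} xp (p≢a , p≢b) ys (s≢a , s≢b) = decidable-stable (adj? p s) λ p≁s →
          no-unit record
            { aq = xp ; br = ys ; q≢x = p≢a ; q≢y = p≢b ; r≢x = s≢a ; r≢y = s≢b
            ; apart = inj₂ (p≁s ,
                (λ yp → no-unit (commonUnit xp yp p≢a p≢b)) ,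
                (λ xs → no-unit (commonUnit xs ys s≢a s≢b))) }

    -- Two common neighbours complete the square and the other two are units. Only the unit of `x`
    -- and `y` may be missing, in which case `no-unit-root` provides another square.
    manyCommonRoot : ∀ {a b} → a ∉ W → a ≢ b → 4 ≤ length (C a b) → Root W
    manyCommonRoot {a} {b} a∉W a≢b 4≤ =
      let x , ax , bx , _ = C-escapes [] (≤-trans (m≤n⇒m≤o+n 3 ≤-refl) 4≤)
          y , ay , by , y∉ = C-escapes (x ∷ []) (≤-trans (m≤n⇒m≤o+n 2 ≤-refl) 4≤)
          q₁ , aq₁ , bq₁ , q₁∉ = C-escapes (x ∷ y ∷ []) (≤-trans (m≤n⇒m≤o+n 1 ≤-refl) 4≤)
          q₂ , aq₂ , bq₂ , q₂∉ = C-escapes (x ∷ y ∷ q₁ ∷ []) 4≤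
          σ = record { a∉W = a∉W ; ax = ax ; ay = ay ; bx = bx ; by = by ; a≢b = a≢b
                     ; x≢y = y∉ ∘ here ∘ sym }
          q₁≢q₂ = q₂∉ ∘ there ∘ there ∘ here ∘ sym
      in case Fin.any? (λ p → Fin.any? λ s → unit? x y a b p s) of λ
        { (yes (p , s , υ₃)) → configRoot σ
            (commonUnit aq₁ bq₁ (q₁∉ ∘ here) (q₁∉ ∘ there ∘ here))
            (commonUnit aq₂ bq₂ (q₂∉ ∘ here) (q₂∉ ∘ there ∘ here))
            q₁≢q₂ q₁≢q₂ υ₃
        ; (no none) → no-unit-root σ (λ υ → none (_ , _ , υ)) }

    module FewCommon (few : ∀ {a b} → a ∉ W → a ≢ b → length (C a b) ≤ 3) where

      TwoUnits : V → V → V → V → Set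
      TwoUnits a b x y = ∃₂ λ q₁ r₁ → ∃₂ λ q₂ r₂ →
        Unit a b x y q₁ r₁ × Unit a b x y q₂ r₂ × q₁ ≢ q₂ × r₁ ≢ r₂

      module _ {a b x y} (σ : Square a b x y) where
        open Square σ

        -- The third common neighbour is one unit. For the other, take two more neighbours `p` and
        -- `p′` of `a`: they have too few common neighbours to be both joined to all other
        -- neighbours of `b`, so one of them is not adjacent to some `r`. A fourth common neighbour
        -- is excluded by `few`.
        twoUnits-common : ∀ {q} → Adj a q → Adj b q → q ≢ x → q ≢ y → TwoUnits a b x y
        twoUnits-common {q} aq bq q≢x q≢y =
          let p , ap , p∉ = N-escapes a∉W (x ∷ y ∷ q ∷ []) (m≤n⇒m≤o+n 2 ≤-refl)
              p′ , ap′ , p′∉ = N-escapes a∉W (x ∷ y ∷ q ∷ p ∷ []) (m≤n⇒m≤o+n 1 ≤-refl)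
              -- A neighbour of `b` is never `a`, so `a` may be left out of `C p p′`; this brings
              -- the list down to 3 + 2 = 5.
              r , br , r∉ = N-escapes b∉W (x ∷ y ∷ q ∷ remove Fin._≟_ a (C p p′))
                (s≤s (s≤s (s≤s (≤-pred (≤-trans (length-remove Fin._≟_ (∈C⁺ (adj-sym ap) (adj-sym ap′)))
                  (few (live-adj closed a∉W ap) (p′∉ ∘ there ∘ there ∘ there ∘ here ∘ sym)))))))
          in choose ap p∉ ap′ (p′∉ ∘ inFirst) br (r∉ ∘ inFirst) λ pr p′r → r∉ (there (there (there
               (∈-remove⁺ Fin._≟_ (∈C⁺ pr p′r) (b-nbr≢a br)))))
          where
          inFirst : ∀ {v ys} → v ∈ x ∷ y ∷ q ∷ [] → v ∈ x ∷ y ∷ q ∷ ys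
          inFirst = ∈-++⁺ˡ {xs = x ∷ y ∷ q ∷ []}

          no-more : ∀ {v} → v ∉ x ∷ y ∷ q ∷ [] → Adj a v → Adj b v → ⊥
          no-more {v} v∉ av bv = 1+n≰n (≤-trans
            (C-⊇ {vs = v ∷ x ∷ y ∷ q ∷ []}
              (((v∉ ∘ here) ∷ (v∉ ∘ there ∘ here) ∷ (v∉ ∘ there ∘ there ∘ here) ∷ []) ∷
               (x≢y ∷ (q≢x ∘ sym) ∷ []) ∷ ((q≢y ∘ sym) ∷ []) ∷ [] ∷ [])
              ((av , bv) ∷ (ax , bx) ∷ (ay , by) ∷ (aq , bq) ∷ []))
            (few a∉W a≢b))

          units : ∀ {p r} → Adj a p → p ∉ x ∷ y ∷ q ∷ [] → Adj b r → r ∉ x ∷ y ∷ q ∷ [] →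
            ¬ Adj p r → TwoUnits a b x y
          units {p} {r} ap p∉ br r∉ p≁r = q , q , p , r , commonUnit aq bq q≢x q≢y ,
            record { aq = ap ; br = br ; q≢x = p∉ ∘ here ; q≢y = p∉ ∘ there ∘ here
                   ; r≢x = r∉ ∘ here ; r≢y = r∉ ∘ there ∘ here
                   ; apart = inj₂ (p≁r , no-more p∉ ap , λ ar → no-more r∉ ar br) } ,
            (λ { refl → p∉ (there (there (here refl))) }) , (λ { refl → r∉ (there (there (here refl))) })

          choose : ∀ {p p′ r} → Adj a p → p ∉ x ∷ y ∷ q ∷ [] → Adj a p′ → p′ ∉ x ∷ y ∷ q ∷ [] →
            Adj b r → r ∉ x ∷ y ∷ q ∷ [] → (Adj p r → Adj p′ r → ⊥) → TwoUnits a b x y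
          choose {p} {p′} {r} ap p∉ ap′ p′∉ br r∉ ¬both with adj? p r | adj? p′ r
          ... | no p≁r | _       = units ap p∉ br r∉ p≁r
          ... | yes _  | no p′≁r = units ap′ p′∉ br r∉ p′≁r
          ... | yes pr | yes p′r = ⊥-elim (¬both pr p′r)

        -- A vertex `q` has at most three common neighbours with `b`, which with `x` and `y` leaves
        -- a neighbour of `b` not adjacent to `q`; the same holds with the sides exchanged. So in
        -- the bipartite graph of non-adjacent pairs no vertex is isolated, and two disjoint pairs
        -- exist.
        twoUnits-disjoint : (∀ {q} → Adj a q → Adj b q → q ≢ x → q ≢ y → ⊥) → TwoUnits a b x y
        twoUnits-disjoint none =
          let q₁ , aq₁ , q₁∉ = N-escapes a∉W (x ∷ y ∷ []) (m≤n⇒m≤o+n 3 ≤-refl)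
              q₂ , aq₂ , q₂∉ = N-escapes a∉W (x ∷ y ∷ q₁ ∷ []) (m≤n⇒m≤o+n 2 ≤-refl)
              r₁ , br₁ , r₁∉ = avoid-b (live-adj closed a∉W aq₁) (a-nbr≢b aq₁)
              r₂ , br₂ , r₂∉ = avoid-b (live-adj closed a∉W aq₂) (a-nbr≢b aq₂)
              r₃ , br₃ , r₃∉ = N-escapes b∉W (x ∷ y ∷ r₁ ∷ []) (m≤n⇒m≤o+n 2 ≤-refl)
              q₃ , aq₃ , q₃∉ = avoid-a (live-adj closed b∉W br₃) (b-nbr≢a br₃)
          in choose
               (unit aq₁ q₁∉ br₁ (r₁∉ ∘ first) (λ qr → r₁∉ (there (there (∈C⁺ qr br₁)))))
               (unit aq₂ (q₂∉ ∘ first) br₂ (r₂∉ ∘ first) (λ qr → r₂∉ (there (there (∈C⁺ qr br₂)))))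
               (unit aq₃ (q₃∉ ∘ first) br₃ (r₃∉ ∘ first) (λ qr → q₃∉ (there (there (∈C⁺ (adj-sym qr) aq₃)))))
               (q₂∉ ∘ there ∘ there ∘ here ∘ sym) (r₃∉ ∘ there ∘ there ∘ here ∘ sym)
          where
          avoid-b : ∀ {q} → q ∉ W → q ≢ b → ∃ λ r → Adj b r × r ∉ x ∷ y ∷ C q b
          avoid-b {q} q∉W q≢b = N-escapes b∉W (x ∷ y ∷ C q b) (s≤s (s≤s (few q∉W q≢b)))

          avoid-a : ∀ {r} → r ∉ W → r ≢ a → ∃ λ q → Adj a q × q ∉ x ∷ y ∷ C r a
          avoid-a {r} r∉W r≢a = N-escapes a∉W (x ∷ y ∷ C r a) (s≤s (s≤s (few r∉W r≢a)))

          first : ∀ {v ys} → v ∈ x ∷ y ∷ [] → v ∈ x ∷ y ∷ ys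
          first = ∈-++⁺ˡ {xs = x ∷ y ∷ []}

          unit : ∀ {q r} → Adj a q → q ∉ x ∷ y ∷ [] → Adj b r → r ∉ x ∷ y ∷ [] → ¬ Adj q r →
            Unit a b x y q r
          unit aq q∉ br r∉ q≁r = record
            { aq = aq ; br = br ; q≢x = q∉ ∘ here ; q≢y = q∉ ∘ there ∘ here
            ; r≢x = r∉ ∘ here ; r≢y = r∉ ∘ there ∘ here
            ; apart = inj₂ (q≁r ,
                (λ bq → none aq bq (q∉ ∘ here) (q∉ ∘ there ∘ here)) ,
                (λ ar → none ar br (r∉ ∘ here) (r∉ ∘ there ∘ here))) }

          choose : ∀ {q₁ q₂ q₃ r₁ r₂ r₃} → Unit a b x y q₁ r₁ → Unit a b x y q₂ r₂ → Unit a b x y q₃ r₃ →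
            q₁ ≢ q₂ → r₁ ≢ r₃ → TwoUnits a b x y
          choose {q₁} {q₂} {q₃} {r₁} {r₂} {r₃} υ₁ υ₂ υ₃ q₁≢q₂ r₁≢r₃ with r₁ Fin.≟ r₂ | q₁ Fin.≟ q₃
          ... | no r₁≢r₂ | _        = q₁ , r₁ , q₂ , r₂ , υ₁ , υ₂ , q₁≢q₂ , r₁≢r₂
          ... | yes _    | no q₁≢q₃ = q₁ , r₁ , q₃ , r₃ , υ₁ , υ₃ , q₁≢q₃ , r₁≢r₃
          -- The pairs are now `q₁r₁`, `q₂r₁` and `q₁r₃`, of which the last two are disjoint.
          ... | yes refl | yes refl = q₂ , r₂ , q₃ , r₃ , υ₂ , υ₃ , q₁≢q₂ ∘ sym , r₁≢r₃

        twoUnits : TwoUnits a b x y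
        twoUnits with Fin.any? (λ q → adj? a q ×-dec (adj? b q ×-dec (¬? (q Fin.≟ x) ×-dec ¬? (q Fin.≟ y))))
        ... | yes (q , aq , bq , q≢x , q≢y) = twoUnits-common aq bq q≢x q≢y
        ... | no none = twoUnits-disjoint λ aq bq q≢x q≢y → none (_ , aq , bq , q≢x , q≢y)

      -- Every square has two units at either pair of opposite corners; one of those at `x` and `y`
      -- is enough.
      twoCommonRoot : ∀ {a b} → a ∉ W → a ≢ b → 2 ≤ length (C a b) → Root W
      twoCommonRoot {a} {b} a∉W a≢b 2≤ =
        let x , ax , bx , _ = C-escapes [] (≤-trans (s≤s z≤n) 2≤)
            y , ay , by , y∉ = C-escapes (x ∷ []) 2≤
            σ = record { a∉W = a∉W ; ax = ax ; ay = ay ; bx = bx ; by = by ; a≢b = a≢b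
                       ; x≢y = y∉ ∘ here ∘ sym }
            q₁ , r₁ , q₂ , r₂ , υ₁ , υ₂ , q₁≢q₂ , r₁≢r₂ = twoUnits σ
            p , s , _ , _ , υ₃ , _ = twoUnits (square-transpose σ)
        in configRoot σ υ₁ υ₂ q₁≢q₂ r₁≢r₂ υ₃

    -- Girth at least five

    module FiveSpokes (few : ∀ {a b} → a ∉ W → a ≢ b → length (C a b) ≤ 1) {v} (v∉W : v ∉ W) where

      no-square : ∀ {a b x y} → a ∉ W → a ≢ b → Adj a x → Adj b x → Adj a y → Adj b y → x ≡ y
      no-square {x = x} {y} a∉W a≢b ax bx ay by = decidable-stable (x Fin.≟ y) λ x≢y →
        1+n≰n (≤-trans (C-⊇ ((x≢y ∷ []) ∷ [] ∷ []) ((ax , bx) ∷ (ay , by) ∷ [])) (few a∉W a≢b))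

      Spoke : V × V → Set
      Spoke (w , x) = Adj v w × Adj w x × x ≢ v

      ≁v : ∀ {w x} → Spoke (w , x) → ¬ Adj v x
      ≁v (vw , wx , _) vx = triangle-free v∉W vw wx vx

      _≢₁_ : V × V → V × V → Set
      m ≢₁ m′ = proj₁ m ≢ proj₁ m′

      record Spokes (l : ℕ) : Set where
        field
          M        : List (V × V)
          length-M : length M ≡ l
          spokes    : All Spoke M
          distinct : AllPairs _≢₁_ M
          c        : Colouring
          proper′  : Proper c
          painted  : All (λ m → uncurry c m ≡ just zero) M
          onSpokes  : ∀ {y z k} → c y z ≡ just k → k ≡ zero × ∃ λ m → m ∈ M × Same y z (proj₁ m) (proj₂ m)

      -- At most four neighbours of `v` are taken, so a new `w` exists. Then `x` has to avoid `v`
      -- and, for each of the at most four old spokes, the at most one common neighbour of `w` with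
      -- its outer end: five vertices out of six.
      addSpoke : ∀ {l} → l ≤ 4 → Spokes l → Spokes (suc l)
      addSpoke {l} l≤4 S =
        let w , vw , w∉ = N-escapes v∉W (map proj₁ M) (≤-trans (≤-reflexive (trans (length-map proj₁ M) length-M))
              (m≤n⇒m≤1+n l≤4))
            w∉W = live-adj closed v∉W vw
            x , wx , x∉ = N-escapes w∉W (v ∷ concatMap (λ m → C w (proj₂ m)) M)
              (s≤s (≤-trans (length-concatMap≤ (All.tabulate λ m∈M → few w∉W (w≢ vw m∈M)))
                (≤-trans (≤-reflexive (trans (*-identityʳ (length M)) length-M)) l≤4)))
        in add vw w∉W w∉ wx (x∉ ∘ here) λ m∈M mx → x∉ (there
             (∈-concatMap⁺ (λ m → C w (proj₂ m)) (lose m∈M (∈C⁺ wx mx))))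
        where
        open Spokes S

        w≢ : ∀ {w} → Adj v w → ∀ {m} → m ∈ M → w ≢ proj₂ m
        w≢ vw m∈M refl = ≁v (All.lookup spokes m∈M) vw

        add : ∀ {w x} → Adj v w → w ∉ W → w ∉ map proj₁ M → Adj w x → x ≢ v →
          (∀ {m} → m ∈ M → ¬ Adj (proj₂ m) x) → Spokes (suc l)
        add {w} {x} vw w∉W w∉ wx x≢v x≁ = record
          { M = (w , x) ∷ M
          ; length-M = cong suc length-M
          ; spokes = (vw , wx , x≢v) ∷ spokes
          ; distinct = All.tabulate (λ { m∈M refl → w∉ (∈-map⁺ proj₁ m∈M) }) ∷ distinct
          ; c = paint w x zero c
          ; proper′ = paint-proper proper′ wx free
          ; painted = paint-new (inj₁ (refl , refl)) ∷ All.map (paint-⊑ proper′ new) painted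
          ; onSpokes = λ eq → case paint-inv eq of λ
              { (inj₁ (same , k≡)) → k≡ , (w , x) , here refl , same
              ; (inj₂ old) → let k≡ , m , m∈M , same = onSpokes old in k≡ , m , there m∈M , same }
          }
          where
          new : ∀ {k} → c w x ≢ just k
          new eq with onSpokes eq
          ... | _ , m , m∈M , inj₁ (refl , _) = w∉ (∈-map⁺ proj₁ m∈M)
          ... | _ , m , m∈M , inj₂ (refl , _) = w≢ vw m∈M refl

          -- Against an old spoke `w′x′`, adjacency of `w` and `w′` would give a triangle, that of
          -- `x` and `w′` or of `w` and `x′` a square, and that of `x` and `x′` was avoided by the
          -- choice of `x`.
          free : Free c w x zero
          free near _ eq with onSpokes eq
          ... | _ , m , m∈M , same with All.lookup spokes m∈M | same | near
          ...   | vw′ , w′x′ , x′≢v | inj₁ (refl , refl) | inj₁ (ww′ , _) = triangle-free v∉W vw ww′ vw′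
          ...   | vw′ , w′x′ , x′≢v | inj₁ (refl , refl) | inj₂ (xw′ , w′≢w) =
            x≢v (no-square w∉W (w′≢w ∘ sym) wx (adj-sym xw′) (adj-sym vw) (adj-sym vw′))
          ...   | vw′ , w′x′ , x′≢v | inj₂ (refl , refl) | inj₁ (wx′ , _) =
            w∉ (subst (_∈ map proj₁ M)
              (no-square v∉W (x′≢v ∘ sym) vw′ (adj-sym w′x′) vw (adj-sym wx′)) (∈-map⁺ proj₁ m∈M))
          ...   | vw′ , w′x′ , x′≢v | inj₂ (refl , refl) | inj₂ (xx′ , _) = x≁ m∈M (adj-sym xx′)

      noSpokes : Spokes 0
      noSpokes = record
        { M = [] ; length-M = refl ; spokes = [] ; distinct = []
        ; c = ∅ ; proper′ = ∅-proper ; painted = [] ; onSpokes = λ () }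

      module _ (S : Spokes 5) where
        open Spokes S

        module _ {d z} (d-proper : Proper d) (c⊑d : c ⊑ d) (vz : Adj v z) where

          -- The dart through which the edge vz sees a spoke.
          seen : V × V → V × V
          seen (w , x) with w Fin.≟ z
          ... | yes _ = x , w
          ... | no _  = w , x

          seen-dart : ∀ {m} → Spoke m → Dart v z (seen m)
          seen-dart {w , x} (vw , wx , x≢v) with w Fin.≟ z
          ... | yes refl = inj₂ (wx , x≢v) , adj-sym wx
          ... | no w≢z = inj₁ (vw , w≢z) , wx

          seen-colour : ∀ {m} → uncurry c m ≡ just zero → uncurry d (seen m) ≡ just zero
          seen-colour {w , x} eq with w Fin.≟ z
          ... | yes _ = flip d-proper (c⊑d eq)
          ... | no _ = c⊑d eq

          -- A reversed dart starts at a non-neighbour of `v` and an unreversed one at a neighbour;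
          -- darts of the same kind differ in the inner end of the spoke.
          seen-distinct : ∀ {m m′} → Spoke m → Spoke m′ → m ≢₁ m′ → seen m ≢ seen m′
          seen-distinct {w , x} {w′ , x′} spoke spoke′ w≢w′ eq with w Fin.≟ z | w′ Fin.≟ z
          ... | yes _ | yes _ = w≢w′ (cong proj₂ eq)
          ... | no _ | no _ = w≢w′ (cong proj₁ eq)
          ... | yes _ | no _ = ≁v spoke (subst (Adj v) (sym (cong proj₁ eq)) (proj₁ spoke′))
          ... | no _ | yes _ = ≁v spoke′ (subst (Adj v) (cong proj₁ eq) (proj₁ spoke))

          seen-allPairs : ∀ {L} → All Spoke L → AllPairs _≢₁_ L → AllPairs (λ m m′ → seen m ≢ seen m′) L
          seen-allPairs [] [] = []
          seen-allPairs (spoke ∷ spokes) (≢s ∷ ≢ss) =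
            All.map (λ (spoke′ , ≢m) → seen-distinct spoke spoke′ ≢m) (All.zip (spokes , ≢s)) ∷
            seen-allPairs spokes ≢ss

          -- The edge sees five darts of colour `zero`; the first vouches for the other four.
          colourable-from-spokes : ∀ {L} → length L ≡ 5 → All Spoke L → AllPairs _≢₁_ L →
            All (λ m → uncurry c m ≡ just zero) L → Colourable d v z
          colourable-from-spokes {m ∷ L} ≡5 (spoke ∷ spokes) ≢s (col ∷ cols)
            with seen≢s ∷ uniq ← seen-allPairs (spoke ∷ spokes) ≢s =
            colourable-redundant vz (map seen L) (trans (length-map seen L) (suc-injective ≡5))
              (AllPairs.map⁺ uniq) (All.map⁺ (All.map seen-dart spokes))
              (All.map⁺ (All.map (λ col′ → inj₂ (seen m , seen-dart spoke ,
                All.All¬⇒¬Any (All.map⁺ seen≢s) , trans (seen-colour col) (sym (seen-colour col′)))) cols))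

        rootFromSpokes : Root W
        rootFromSpokes = record
          { R = v ∷ []
          ; r∈R = here refl
          ; live = λ { (here refl) → v∉W }
          ; pre = c
          ; pre-proper = proper′
          ; pre-near = λ eq → case onSpokes eq of λ
              { (_ , m , m∈M , inj₁ (refl , _)) → inj₁ (v , here refl , inj₂ (proj₁ (All.lookup spokes m∈M)))
              ; (_ , m , m∈M , inj₂ (_ , refl)) → inj₂ (v , here refl , inj₂ (proj₁ (All.lookup spokes m∈M))) }
          ; pre-outer = λ { (here refl) (here refl) eq → adj-irrefl (onEdges proper′ eq) }
          ; pre-few = λ _ → zero ∷ [] , s≤s z≤n , λ eq → here (proj₁ (onSpokes eq))
          ; pendant = λ { d-proper c⊑d _ (here refl) _ vz →
              colourable-from-spokes d-proper c⊑d vz length-M spokes distinct painted }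
          ; core = λ { _ _ (here refl) (here refl) e → ⊥-elim (adj-irrefl e) }
          }

      fiveSpokesRoot : Root W
      fiveSpokesRoot = rootFromSpokes (addSpoke ≤-refl (addSpoke (m≤n⇒m≤o+n 1 ≤-refl) (addSpoke (m≤n⇒m≤o+n 2 ≤-refl)
        (addSpoke (m≤n⇒m≤o+n 3 ≤-refl) (addSpoke z≤n noSpokes)))))

  -- Choice of the root and the final colouring.

  root : ∀ {W} → Closed W → ∀ {v} → v ∉ W → Root W
  -- Each search runs over all vertices outside `W`, not just the component of `v`, so its failure
  -- gives a property of everything still to be coloured.
  root {W} closed {v} v∉W with Fin.any? (λ u → (u ∉? W) ×-dec (length (N u) ≤? 5))
  ... | yes (u , u∉W , ≤5) = lowDegreeRoot u∉W ≤5
  ... | no none₅ with Fin.any? (λ u → Fin.any? λ v → Fin.any? λ w →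
                       (u ∉? W) ×-dec (adj? u v ×-dec (adj? v w ×-dec adj? u w)))
  ...   | yes (_ , _ , _ , u∉W , uv , vw , uw) = triangleRoot closed u∉W uv vw uw
  ...   | no noneΔ = regular
    where
    six : ∀ {u} → u ∉ W → 6 ≤ length (N u)
    six u∉W = ≰⇒> λ ≤5 → none₅ (_ , u∉W , ≤5)

    open Regular closed six (λ u∉W uv vw uw → noneΔ (_ , _ , _ , u∉W , uv , vw , uw))

    common? : ∀ m → Dec (∃₂ λ a b → a ∉ W × a ≢ b × m ≤ length (C a b))
    common? m = Fin.any? λ a → Fin.any? λ b → (a ∉? W) ×-dec (¬? (a Fin.≟ b) ×-dec (m ≤? length (C a b)))

    few : ∀ {m} → ¬ (∃₂ λ a b → a ∉ W × a ≢ b × suc m ≤ length (C a b)) →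
      ∀ {a b} → a ∉ W → a ≢ b → length (C a b) ≤ m
    few none a∉W a≢b = ≤-pred (≰⇒> λ m< → none (_ , _ , a∉W , a≢b , m<))

    regular : Root W
    regular with common? 4 | common? 2
    ... | yes (_ , _ , a∉W , a≢b , 4≤) | _ = manyCommonRoot a∉W a≢b 4≤
    ... | no none | yes (_ , _ , a∉W , a≢b , 2≤) = FewCommon.twoCommonRoot (few none) a∉W a≢b 2≤
    ... | no _ | no none = FiveSpokes.fiveSpokesRoot (few none) v∉W

  strongEdgeColourable-57 : StrongEdgeColourable G 57
  strongEdgeColourable-57 = fromProper (colourOutside root (outside []) ≤-refl λ ())
    where
    open Edge

    fromProper : ColouringOutside [] → StrongEdgeColourable G 57
    fromProper (c , proper , _ , coloured) = colour , λ i → matching i , induced i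
      where
      colour : Edge G → Fin 57
      -- The default is never taken: with `W` empty, every edge is coloured.
      colour e = fromMaybe zero (c (end₁ e) (end₂ e))

      adjacent′ : ∀ e → Adj (end₁ e) (end₂ e)
      -- The irrelevant adjacency proof is recovered from its decision.
      adjacent′ (edge u v _ uv) = recompute (adj? u v) uv

      colour-c : ∀ {e i} → colour e ≡ i → c (end₁ e) (end₂ e) ≡ just i
      colour-c {e} refl with k , eq ← coloured (adjacent′ e) (λ ()) (λ ()) =
        trans eq (cong just (sym (cong (fromMaybe zero) eq)))

      fromEnd : ∀ {x e i} → x isEndOf e → colour e ≡ i →
        ∃ λ y → Same x y (end₁ e) (end₂ e) × c y x ≡ just i
      fromEnd {e = e} (inj₁ refl) eq = end₂ e , inj₁ (refl , refl) , flip proper (colour-c {e} eq)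
      fromEnd {e = e} (inj₂ refl) eq = end₁ e , inj₂ (refl , refl) , colour-c {e} eq

      same⇒≡ : ∀ {x y} e f → Same x y (end₁ e) (end₂ e) → Same x y (end₁ f) (end₂ f) → e ≡ f
      same⇒≡ (edge _ _ _ _) (edge _ _ _ _) (inj₁ (refl , refl)) (inj₁ (refl , refl)) = refl
      same⇒≡ (edge _ _ _ _) (edge _ _ _ _) (inj₂ (refl , refl)) (inj₂ (refl , refl)) = refl
      same⇒≡ (edge _ _ u<v _) (edge _ _ v<u _) (inj₁ (refl , refl)) (inj₂ (refl , refl)) =
        ⊥-elim-irr (Fin.<-asym u<v v<u)
      same⇒≡ (edge _ _ u<v _) (edge _ _ v<u _) (inj₂ (refl , refl)) (inj₁ (refl , refl)) =
        ⊥-elim-irr (Fin.<-asym u<v v<u)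

      matching : ∀ i → IsMatching (ColourClass colour i)
      matching i e f ei fi x x∈e x∈f with fromEnd {e = e} x∈e ei | fromEnd {e = f} x∈f fi
      ... | y , same , cyx | z , same′ , czx with y Fin.≟ z
      ...   | yes refl = same⇒≡ e f same same′
      -- The degenerate walk `z – x – y – x` witnesses the conflict of two edges at `x`.
      ...   | no y≢z = ⊥-elim (clashFree proper (onEdges proper (flip proper cyx)) y≢z czx cyx)

      -- The ends of `e` are covered by edges `zu` and `wx` of colour `i`. Either `w` is `z` and `e`
      -- is the edge `f`, or `e` joins the two in a forbidden walk.
      induced : ∀ i → IsInduced (ColourClass colour i)
      induced i e (f , fi , u∈f) (g , gi , w∈g) with fromEnd {e = f} u∈f fi | fromEnd {e = g} w∈g gi
      ... | z , same , czu | x , _ , cxw with end₂ e Fin.≟ z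
      ...   | yes refl = trans (cong colour (same⇒≡ e f (inj₁ (refl , refl)) same)) fi
      ...   | no w≢z = ⊥-elim (clashFree proper (adjacent′ e) w≢z czu (flip proper cxw))

degree≤Δ : ∀ {n} (G : Graph n) v → degree G v ≤ Δ G
degree≤Δ G v = All.lookup (xs≤max 0 (map (degree G) (allFin _))) (∈-map⁺ (degree G) (∈-allFin v))

theorem1p1 : ∀ {n : ℕ} (G : Graph n) → Δ G ≤ 6 → χ′ₛ G ≤ 57
theorem1p1 G Δ≤6 = χ′ₛ-minimal G
  (ChromaticBound.strongEdgeColourable-57 G λ v → ≤-trans (degree≤Δ G v) Δ≤6)
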